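{- Let $0<\epsilon\le2^{ -50}$ and $n=2^{2^{ -45}\epsilon^{ -2}}$. There is an edge-weighted bipartite graph $G$ with parts $U,V$, $|U|=|V|=n$, and weights in $[0,1]$ such that no partitions $P_1:U=U_1\cup\dots\cup U_k$ of $U$ with $k\le n/2$ and $P_2:V=V_1\cup\dots\cup V_{k'}$ of $V$ (with any $k'$) form a weak $\epsilon$-regular partition of $G$. Consequently $k_0(\epsilon)>2^{2^{ -46}\epsilon^{ -2}}$.
   Context: For a weighted bipartite graph $G$ on $U\cup V$ with weights $w(u,v)\in[0,1]$, $e_w(A,B)=\sum_{a\in A,b\in B}w(a,b)$ and $d_w(A,B)=e_w(A,B)/(|A||B|)$. For partitions $P_1$ of $U$ and $P_2$ of $V$, $f_{P_1,P_2}(A,B)=e_w(A,B)-\sum_{i,j}d_w(U_i,V_j)|U_i\cap A||V_j\cap B|$; the pair $P_1,P_2$ forms a weak $\epsilon$-regular partition if $|f_{P_1,P_2}(A,B)|\le\epsilon n^2$ for all $A\subset U$, $B\subset V$. $k_0(\epsilon)$ denotes the least integer such that every edge-weighted bipartite graph with weights in $[0,1]$ and two parts of equal size has partitions $P_1$, $P_2$ of its two parts, each with at most $k_0(\epsilon)$ parts, forming a weak $\epsilon$-regular partition. ($n$ is rounded to an integer.)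
   Formalization: The parameter ε ranges over positive rational numbers at most 2^-50 instead of real ones (edge weights are rational too, which only strengthens the existence claim). -}

module Defs where

open import Data.Nat as ℕ using (ℕ; zero; suc; _^_)
open import Data.Integer as ℤ using (+_)
open import Data.Fin using (Fin; zero; suc)
open import Data.Fin.Subset using (Subset; _∩_) renaming (∣_∣ to card)
open import Data.Vec using (tabulate)
open import Data.Rational using (ℚ; 0ℚ; 1ℚ; _+_; _-_; _*_; _/_; _≤_; ∣_∣; ↥_; ↧ₙ_)
open import Data.Bool using (Bool; if_then_else_)
open import Data.Vec using (lookup)
open import Data.Fin.Properties using (_≟_)
open import Relation.Nullary.Decidable using (⌊_⌋)
open import Data.Product using (Σ; _×_; ∃)
open import Relation.Nullary using (¬_)

ℕ→ℚ : ℕ → ℚ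
ℕ→ℚ m = + m / 1

sumFin : (m : ℕ) → (Fin m → ℚ) → ℚ
sumFin zero    f = 0ℚ
sumFin (suc m) f = f zero + sumFin m (λ i → f (suc i))

-- an edge-weighted bipartite graph with parts U = Fin n, V = Fin n:
-- w u v is the weight of the edge (u , v), u ∈ U, v ∈ V
Weights : ℕ → Set
Weights n = Fin n → Fin n → ℚ

WeightsIn01 : ∀ {n} → Weights n → Set
WeightsIn01 {n} w = ∀ (u v : Fin n) → (0ℚ ≤ w u v) × (w u v ≤ 1ℚ)

indicator : ∀ {n} → Subset n → Fin n → ℚ
indicator A x = if lookup A x then 1ℚ else 0ℚ

e-w : ∀ {n} → Weights n → Subset n → Subset n → ℚ
e-w {n} w A B = sumFin n (λ u → sumFin n (λ v → indicator A u * indicator B v * w u v))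

-- x / m for a natural m (value 0 when m = 0; only ever multiplied by 0 then)
divℕ : ℚ → ℕ → ℚ
divℕ x zero    = 0ℚ
divℕ x (suc m) = x * (+ 1 / suc m)

d-w : ∀ {n} → Weights n → Subset n → Subset n → ℚ
d-w w A B = divℕ (e-w w A B) (card A ℕ.* card B)

-- a partition of a set Fin n into (at most) k parts, given by a labelling;
-- part i is the set of vertices labelled i
Partition : ℕ → ℕ → Set
Partition n k = Fin n → Fin k

part : ∀ {n k} → Partition n k → Fin k → Subset n
part P i = tabulate (λ x → ⌊ P x ≟ i ⌋)

f-P : ∀ {n k k'} → Weights n → Partition n k → Partition n k' → Subset n → Subset n → ℚ
f-P {n} {k} {k'} w P₁ P₂ A B =
  e-w w A B -
  sumFin k (λ i → sumFin k' (λ j →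
    d-w w (part P₁ i) (part P₂ j) * ℕ→ℚ (card (part P₁ i ∩ A)) * ℕ→ℚ (card (part P₂ j ∩ B))))

WeakRegular : ∀ {n k k'} → ℚ → Weights n → Partition n k → Partition n k' → Set
WeakRegular {n} ε w P₁ P₂ =
  ∀ (A B : Subset n) → ∣ f-P w P₁ P₂ A B ∣ ≤ ε * ℕ→ℚ (n ℕ.* n)

-- "every edge-weighted bipartite graph with weights in [0,1] and two parts of
-- equal size has partitions with at most K parts each forming a weak ε-regular
-- partition";  k₀(ε) is the least K with this property, so k₀(ε) > K ⇔ ¬ this.
RegularityHolds : ℚ → ℕ → Set
RegularityHolds ε K =
  ∀ (n : ℕ) (w : Weights n) → WeightsIn01 w →
  Σ ℕ λ k → Σ ℕ λ k' → (k ℕ.≤ K) × (k' ℕ.≤ K) ×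
  Σ (Partition n k) λ P₁ → Σ (Partition n k') λ P₂ → WeakRegular ε w P₁ P₂

-- numerator (as ℕ, ε > 0) and denominator of ε
numε : ℚ → ℕ
numε ε = ℤ.∣ ↥ ε ∣

denε : ℚ → ℕ
denε ε = ↧ₙ ε

-- IsFloorPow2 m c ε : m = ⌊ 2 ^ (2^(-c) ε^(-2)) ⌋.
-- With ε = p/r this exponent is r² / (2^c p²), so the condition reads
-- m^(2^c p²) ≤ 2^(r²) < (m+1)^(2^c p²).
IsFloorPow2 : ℕ → ℕ → ℚ → Set
IsFloorPow2 m c ε =
  (m ^ b ℕ.≤ 2 ^ a) × (2 ^ a ℕ.< suc m ^ b)
  where
  a = denε ε ℕ.* denε ε
  b = 2 ^ c ℕ.* (numε ε ℕ.* numε ε)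

{-# OPTIONS --safe #-}
module Submission where

-- Let 2 ^ ℓ ≤ n < 2 ^ (ℓ + 1).  To each u ∈ U attach a word x(u) over an alphabet of 16
-- letters so that distinct words disagree in at least half of their ℓ places, and identify
-- 2 ^ ℓ vertices of V with the cube y ∈ {±1} ^ ℓ.  There the weights are the Riesz product
-- w(u , y) = 1/2 + 1/4 Im Πⱼ (1 + i α xⱼ(u) yⱼ) with α = 512 ε.  The modulus of the product
-- stays below 2 since ℓ α² is small, so no truncation is needed, and by orthogonality
-- Σ_y yⱼ w(u , y) = K xⱼ(u) exactly, with K = 2 ^ ℓ α / 4.
-- A weak ε-regular partition makes Σ_u |K xⱼ(u) - gⱼ(part of u)| ≤ 4 ε n² for every j, because
-- f is additive over u ∈ A.  But two vertices in one part cannot both have Σⱼ |K xⱼ - gⱼ| < K ℓ / 4,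
-- so at least n - k ≥ n / 2 vertices u contribute K ℓ / 4 each, which exceeds 4 ε n² ℓ in total.

open import Defs

-- Finite sums of rationals and the embedding of the naturals.

module RationalSums where
  open import Algebra.Bundles using (CommutativeMonoid)
  import Algebra.Properties.CommutativeSemigroup
  open import Data.Bool.Base using (if_then_else_)
  open import Data.Fin.Base using (Fin; zero; suc; _↑ˡ_; _↑ʳ_; combine)
  open import Data.Fin.Properties using (_≟_)
  open import Data.Integer.Base as ℤ using ()
  import Data.Integer.Properties as ℤ
  open import Data.Nat.Base as ℕ using (ℕ; zero; suc)
  open import Data.Rational.Base using (ℚ; 0ℚ; 1ℚ; _+_; _-_; _*_; _≤_; _<_; nonNegative; toℚᵘ)
  open import Data.Rational.Properties hiding (_≟_)
  open import Data.Rational.Solver using (module +-*-Solver)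
  open import Data.Rational.Unnormalised.Base as ℚᵘ using (mkℚᵘ; *≡*; *≤*)
  import Data.Rational.Unnormalised.Properties as ℚᵘ
  open import Data.Sum.Base using (inj₁; inj₂)
  open import Relation.Binary.PropositionalEquality
  open import Relation.Nullary using (¬_)
  open import Relation.Nullary.Decidable using (⌊_⌋; yes; no)

  open Algebra.Properties.CommutativeSemigroup
    (CommutativeMonoid.commutativeSemigroup +-0-commutativeMonoid) using (interchange) public

  -- `ℕ→ℚ` normalises through a gcd, which does not reduce for a variable m. Facts about it are
  -- therefore checked on unnormalised rationals, where equality is cross-multiplication.
  toℚᵘ-ℕ→ℚ : ∀ m → toℚᵘ (ℕ→ℚ m) ℚᵘ.≃ mkℚᵘ (ℤ.+ m) 0
  toℚᵘ-ℕ→ℚ m = toℚᵘ-fromℚᵘ (mkℚᵘ (ℤ.+ m) 0)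

  ℕ→ℚ-+ : ∀ m n → ℕ→ℚ (m ℕ.+ n) ≡ ℕ→ℚ m + ℕ→ℚ n
  ℕ→ℚ-+ m n = toℚᵘ-injective (begin
    toℚᵘ (ℕ→ℚ (m ℕ.+ n))              ≈⟨ toℚᵘ-ℕ→ℚ (m ℕ.+ n) ⟩
    mkℚᵘ (ℤ.+ (m ℕ.+ n)) 0              ≈⟨ *≡* (cong (ℤ._* ℤ.+ 1) (sym (cong₂ ℤ._+_ (ℤ.*-identityʳ (ℤ.+ m)) (ℤ.*-identityʳ (ℤ.+ n))))) ⟩
    mkℚᵘ (ℤ.+ m) 0 ℚᵘ.+ mkℚᵘ (ℤ.+ n) 0    ≈⟨ ℚᵘ.+-cong (toℚᵘ-ℕ→ℚ m) (toℚᵘ-ℕ→ℚ n) ⟨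
    toℚᵘ (ℕ→ℚ m) ℚᵘ.+ toℚᵘ (ℕ→ℚ n)    ≈⟨ toℚᵘ-homo-+ (ℕ→ℚ m) (ℕ→ℚ n) ⟨
    toℚᵘ (ℕ→ℚ m + ℕ→ℚ n)              ∎)
    where open ℚᵘ.≃-Reasoning

  ℕ→ℚ-* : ∀ m n → ℕ→ℚ (m ℕ.* n) ≡ ℕ→ℚ m * ℕ→ℚ n
  ℕ→ℚ-* m n = toℚᵘ-injective (begin
    toℚᵘ (ℕ→ℚ (m ℕ.* n))              ≈⟨ toℚᵘ-ℕ→ℚ (m ℕ.* n) ⟩
    mkℚᵘ (ℤ.+ (m ℕ.* n)) 0              ≈⟨ *≡* (cong (ℤ._* ℤ.+ 1) (ℤ.pos-* m n)) ⟩
    mkℚᵘ (ℤ.+ m) 0 ℚᵘ.* mkℚᵘ (ℤ.+ n) 0    ≈⟨ ℚᵘ.*-cong (toℚᵘ-ℕ→ℚ m) (toℚᵘ-ℕ→ℚ n) ⟨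
    toℚᵘ (ℕ→ℚ m) ℚᵘ.* toℚᵘ (ℕ→ℚ n)    ≈⟨ toℚᵘ-homo-* (ℕ→ℚ m) (ℕ→ℚ n) ⟨
    toℚᵘ (ℕ→ℚ m * ℕ→ℚ n)              ∎)
    where open ℚᵘ.≃-Reasoning

  ℕ→ℚ-mono-≤ : ∀ {m n} → m ℕ.≤ n → ℕ→ℚ m ≤ ℕ→ℚ n
  ℕ→ℚ-mono-≤ {m} {n} m≤n = toℚᵘ-cancel-≤ (begin
    toℚᵘ (ℕ→ℚ m)   ≃⟨ toℚᵘ-ℕ→ℚ m ⟩
    mkℚᵘ (ℤ.+ m) 0   ≤⟨ *≤* (ℤ.*-monoʳ-≤-nonNeg (ℤ.+ 1) (ℤ.+≤+ m≤n)) ⟩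
    mkℚᵘ (ℤ.+ n) 0   ≃⟨ toℚᵘ-ℕ→ℚ n ⟨
    toℚᵘ (ℕ→ℚ n)   ∎)
    where open ℚᵘ.≤-Reasoning

  0≤p*q : ∀ {p q} → 0ℚ ≤ p → 0ℚ ≤ q → 0ℚ ≤ p * q
  0≤p*q {p} {q} 0≤p 0≤q =
    ≤-trans (≤-reflexive (sym (*-zeroʳ p))) (*-monoˡ-≤-nonNeg p {{nonNegative 0≤p}} 0≤q)

  0≤p² : ∀ p → 0ℚ ≤ p * p
  0≤p² p with ≤-total 0ℚ p
  ... | inj₁ 0≤p = 0≤p*q 0≤p 0≤p
  ... | inj₂ p≤0 = ≤-trans (0≤p*q 0≤-p 0≤-p)
    (≤-reflexive (solve 1 (λ p → (:- p) :* (:- p) := p :* p) refl p))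
    where
    open +-*-Solver
    0≤-p = neg-antimono-≤ p≤0

  <⇒≱ : ∀ {p q} → p < q → ¬ (q ≤ p)
  <⇒≱ p<q q≤p = <-irrefl refl (<-≤-trans p<q q≤p)

  sumFin-cong : ∀ n {f g : Fin n → ℚ} → (∀ i → f i ≡ g i) → sumFin n f ≡ sumFin n g
  sumFin-cong zero    f≗g = refl
  sumFin-cong (suc n) f≗g = cong₂ _+_ (f≗g zero) (sumFin-cong n (λ i → f≗g (suc i)))

  sumFin-mono-≤ : ∀ n {f g : Fin n → ℚ} → (∀ i → f i ≤ g i) → sumFin n f ≤ sumFin n g
  sumFin-mono-≤ zero    f≤g = ≤-refl
  sumFin-mono-≤ (suc n) f≤g = +-mono-≤ (f≤g zero) (sumFin-mono-≤ n (λ i → f≤g (suc i)))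

  sumFin-zero : ∀ n → sumFin n (λ _ → 0ℚ) ≡ 0ℚ
  sumFin-zero zero    = refl
  sumFin-zero (suc n) = trans (+-identityˡ _) (sumFin-zero n)

  sumFin-nonNeg : ∀ n {f : Fin n → ℚ} → (∀ i → 0ℚ ≤ f i) → 0ℚ ≤ sumFin n f
  sumFin-nonNeg n 0≤f = ≤-trans (≤-reflexive (sym (sumFin-zero n))) (sumFin-mono-≤ n 0≤f)

  sumFin-+ : ∀ n (f g : Fin n → ℚ) → sumFin n (λ i → f i + g i) ≡ sumFin n f + sumFin n g
  sumFin-+ zero    f g = refl
  sumFin-+ (suc n) f g = trans
    (cong ((f zero + g zero) +_) (sumFin-+ n (λ i → f (suc i)) (λ i → g (suc i))))
    (interchange (f zero) (g zero) _ _)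

  *-distribˡ-sumFin : ∀ n c (f : Fin n → ℚ) → c * sumFin n f ≡ sumFin n (λ i → c * f i)
  *-distribˡ-sumFin zero    c f = *-zeroʳ c
  *-distribˡ-sumFin (suc n) c f = trans (*-distribˡ-+ c (f zero) _)
    (cong (c * f zero +_) (*-distribˡ-sumFin n c (λ i → f (suc i))))

  *-distribʳ-sumFin : ∀ n c (f : Fin n → ℚ) → sumFin n f * c ≡ sumFin n (λ i → f i * c)
  *-distribʳ-sumFin n c f = trans (*-comm (sumFin n f) c)
    (trans (*-distribˡ-sumFin n c f) (sumFin-cong n (λ i → *-comm c (f i))))

  sumFin-- : ∀ n (f g : Fin n → ℚ) → sumFin n (λ i → f i - g i) ≡ sumFin n f - sumFin n g
  sumFin-- zero    f g = refl
  sumFin-- (suc n) f g = trans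
    (cong ((f zero - g zero) +_) (sumFin-- n (λ i → f (suc i)) (λ i → g (suc i))))
    (solve 4 (λ a b c d → a :- b :+ (c :- d) := a :+ c :- (b :+ d)) refl
      (f zero) (g zero) (sumFin n (λ i → f (suc i))) (sumFin n (λ i → g (suc i))))
    where open +-*-Solver

  sumFin-comm : ∀ m n (f : Fin m → Fin n → ℚ) →
    sumFin m (λ i → sumFin n (f i)) ≡ sumFin n (λ j → sumFin m (λ i → f i j))
  sumFin-comm zero    n f = sym (sumFin-zero n)
  sumFin-comm (suc m) n f = trans
    (cong (sumFin n (f zero) +_) (sumFin-comm m n (λ i → f (suc i))))
    (sym (sumFin-+ n (f zero) (λ j → sumFin m (λ i → f (suc i) j))))

  sumFin-const : ∀ n c → sumFin n (λ _ → c) ≡ ℕ→ℚ n * c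
  sumFin-const zero    c = sym (*-zeroˡ c)
  sumFin-const (suc n) c = begin
    c + sumFin n (λ _ → c)   ≡⟨ cong₂ _+_ (sym (*-identityˡ c)) (sumFin-const n c) ⟩
    1ℚ * c + ℕ→ℚ n * c       ≡⟨ *-distribʳ-+ c 1ℚ (ℕ→ℚ n) ⟨
    (1ℚ + ℕ→ℚ n) * c         ≡⟨ cong (_* c) (ℕ→ℚ-+ 1 n) ⟨
    ℕ→ℚ (suc n) * c          ∎
    where open ≡-Reasoning

  sumFin-++ : ∀ m n (f : Fin (m ℕ.+ n) → ℚ) →
    sumFin (m ℕ.+ n) f ≡ sumFin m (λ i → f (i ↑ˡ n)) + sumFin n (λ j → f (m ↑ʳ j))
  sumFin-++ zero    n f = sym (+-identityˡ _)
  sumFin-++ (suc m) n f = trans (cong (f zero +_) (sumFin-++ m n (λ i → f (suc i))))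
    (sym (+-assoc (f zero) _ _))

  sumFin-combine : ∀ m n (f : Fin (m ℕ.* n) → ℚ) →
    sumFin (m ℕ.* n) f ≡ sumFin m (λ i → sumFin n (λ j → f (combine i j)))
  sumFin-combine zero    n f = refl
  sumFin-combine (suc m) n f = trans (sumFin-++ n (m ℕ.* n) f)
    (cong (sumFin n (λ j → f (j ↑ˡ (m ℕ.* n))) +_) (sumFin-combine m n (λ i → f (n ↑ʳ i))))

  -- Uses the same Boolean test as `part`, so that the indicator of part i at u becomes `δ (P u) i`
  -- once the tabulation is looked up.
  δ : ∀ {k} → Fin k → Fin k → ℚ
  δ a i = if ⌊ a ≟ i ⌋ then 1ℚ else 0ℚ

  δ-suc : ∀ {k} (a i : Fin k) → δ (suc a) (suc i) ≡ δ a i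
  δ-suc a i with a ≟ i
  ... | yes _ = refl
  ... | no  _ = refl

  sumFin-δ : ∀ {k} (f : Fin k → ℚ) a → sumFin k (λ i → f i * δ a i) ≡ f a
  sumFin-δ {suc k} f zero    = begin
    f zero * 1ℚ + sumFin k (λ i → f (suc i) * 0ℚ)
      ≡⟨ cong₂ _+_ (*-identityʳ (f zero)) (trans (sumFin-cong k (λ i → *-zeroʳ (f (suc i)))) (sumFin-zero k)) ⟩
    f zero + 0ℚ                                      ≡⟨ +-identityʳ (f zero) ⟩
    f zero                                           ∎
    where open ≡-Reasoning
  sumFin-δ {suc k} f (suc a) = begin
    f zero * 0ℚ + sumFin k (λ i → f (suc i) * δ (suc a) (suc i))
      ≡⟨ cong₂ _+_ (*-zeroʳ (f zero)) (sumFin-cong k (λ i → cong (f (suc i) *_) (δ-suc a i))) ⟩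
    0ℚ + sumFin k (λ i → f (suc i) * δ a i)                ≡⟨ +-identityˡ _ ⟩
    sumFin k (λ i → f (suc i) * δ a i)                     ≡⟨ sumFin-δ (λ i → f (suc i)) a ⟩
    f (suc a)                                              ∎
    where open ≡-Reasoning

-- A large code over 16 letters whose words pairwise disagree in at least half of their places.

module Codes where
  import Algebra.Properties.Semiring.Sum
  open import Data.Fin.Base using (Fin; zero; suc)
  open import Data.Fin.Properties using (_≟_; any?)
  open import Data.Nat.Base
  open import Data.Nat.Properties hiding (_≟_)
  open import Data.Nat.Solver using (module +-*-Solver)
  open import Data.Product.Base using (∃; _,_; proj₁; proj₂)
  open import Data.Vec.Functional using (_∷_)
  open import Function.Base using (_∘_)
  open import Relation.Binary.PropositionalEquality
  open import Relation.Nullary using (yes; no; contradiction)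
  open Algebra.Properties.Semiring.Sum +-*-semiring using (sum; sum-cong-≗; ∑-comm; *-distribˡ-sum)

  sum-mono-≤ : ∀ {n} {f g : Fin n → ℕ} → (∀ i → f i ≤ g i) → sum f ≤ sum g
  sum-mono-≤ {zero}  f≤g = z≤n
  sum-mono-≤ {suc n} f≤g = +-mono-≤ (f≤g zero) (sum-mono-≤ (f≤g ∘ suc))

  sum-const : ∀ n c → sum {n} (λ _ → c) ≡ n * c
  sum-const zero    c = refl
  sum-const (suc n) c = cong (c +_) (sum-const n c)

  ≤-sum : ∀ {n} (f : Fin n → ℕ) i → f i ≤ sum f
  ≤-sum f zero    = m≤m+n (f zero) _
  ≤-sum f (suc i) = ≤-trans (≤-sum (f ∘ suc) i) (m≤n+m _ (f zero))

  below-average : ∀ q .{{_ : NonZero q}} (f : Fin q → ℕ) M → sum f ≤ q * M → ∃ λ a → f a ≤ M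
  below-average q f M sum≤ with any? (λ a → f a ≤? M)
  ... | yes small = small
  ... | no  ¬small = contradiction sum≤ (<⇒≱ (begin-strict
    q * M                ≡⟨ sum-const q M ⟨
    sum {q} (λ _ → M)    <⟨ sum-mono-< q (λ a → ≰⇒> (λ fa≤M → ¬small (a , fa≤M))) ⟩
    sum f                ∎))
    where
    open ≤-Reasoning
    sum-mono-< : ∀ n .{{_ : NonZero n}} {f g : Fin n → ℕ} → (∀ i → f i < g i) → sum f < sum g
    sum-mono-< (suc n) f<g = +-mono-<-≤ (f<g zero) (sum-mono-≤ (<⇒≤ ∘ f<g ∘ suc))

  same : ∀ {q} → Fin q → Fin q → ℕ
  same a b with a ≟ b
  ... | yes _ = 1
  ... | no  _ = 0

  same-suc : ∀ {q} (a b : Fin q) → same (suc a) (suc b) ≡ same a b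
  same-suc a b with a ≟ b
  ... | yes _ = refl
  ... | no  _ = refl

  same-sym : ∀ {q} (a b : Fin q) → same a b ≡ same b a
  same-sym a b with a ≟ b | b ≟ a
  ... | yes _   | yes _   = refl
  ... | yes a≡b | no  b≢a = contradiction (sym a≡b) b≢a
  ... | no  a≢b | yes b≡a = contradiction (sym b≡a) a≢b
  ... | no  _   | no  _   = refl

  -- Exactly one letter equals b and contributes `suc r`; each of the q - 1 others contributes 1.
  sum-^-same : ∀ {q} r (b : Fin q) → sum (λ a → suc r ^ same a b) ≡ r + q
  sum-^-same {suc q} r zero    = begin
    suc r * 1 + sum {q} (λ _ → 1)   ≡⟨ cong₂ _+_ (*-identityʳ (suc r)) (trans (sum-const q 1) (*-identityʳ q)) ⟩
    suc r + q                       ≡⟨ +-suc r q ⟨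
    r + suc q                       ∎
    where open ≡-Reasoning
  sum-^-same {suc q} r (suc b) = begin
    suc (sum (λ a → suc r ^ same (suc a) (suc b)))  ≡⟨ cong suc (sum-cong-≗ (λ a → cong (suc r ^_) (same-suc a b))) ⟩
    suc (sum (λ a → suc r ^ same a b))              ≡⟨ cong suc (sum-^-same r b) ⟩
    suc (r + q)                                     ≡⟨ +-suc r q ⟨
    r + suc q                                       ∎
    where open ≡-Reasoning

  agreement : ∀ {ℓ q} → (Fin ℓ → Fin q) → (Fin ℓ → Fin q) → ℕ
  agreement x y = sum (λ j → same (x j) (y j))

  agreement-sym : ∀ {ℓ q} (x y : Fin ℓ → Fin q) → agreement x y ≡ agreement y x
  agreement-sym x y = sum-cong-≗ (λ j → same-sym (x j) (y j))

  -- Choosing the letters one at a time: a uniformly random letter multiplies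
  -- the potential Σ φ c · q ^ agreement by (2q - 1) / q < 2 on average.
  avoiding-word : ∀ ℓ q .{{_ : NonZero q}} {m} (φ : Fin m → ℕ) (code : Fin m → Fin ℓ → Fin q) →
    ∃ λ (x : Fin ℓ → Fin q) → sum (λ c → φ c * q ^ agreement x (code c)) ≤ 2 ^ ℓ * sum φ
  avoiding-word zero    q       φ code = (λ ()) , ≤-reflexive
    (trans (sum-cong-≗ (λ c → *-identityʳ (φ c))) (sym (*-identityˡ (sum φ))))
  avoiding-word (suc ℓ) q@(suc r) φ code = (a ∷ x) , (begin
    sum (λ c → φ c * q ^ (same a (code c zero) + agreement x (code c ∘ suc)))
      ≡⟨ sum-cong-≗ (λ c → trans (cong (φ c *_) (^-distribˡ-+-* q (same a (code c zero)) _)) (sym (*-assoc (φ c) _ _))) ⟩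
    sum (λ c → ψ a c * q ^ agreement x (code c ∘ suc))   ≤⟨ proj₂ tail-word ⟩
    2 ^ ℓ * sum (ψ a)                                    ≤⟨ *-monoʳ-≤ (2 ^ ℓ) (proj₂ letter) ⟩
    2 ^ ℓ * (2 * sum φ)                                  ≡⟨ *-assoc (2 ^ ℓ) 2 (sum φ) ⟨
    2 ^ ℓ * 2 * sum φ                                    ≡⟨ cong (_* sum φ) (*-comm (2 ^ ℓ) 2) ⟩
    2 ^ suc ℓ * sum φ                                    ∎)
    where
    open ≤-Reasoning
    ψ : Fin q → _ → ℕ
    ψ a c = φ c * q ^ same a (code c zero)

    sum-ψ : sum (λ a → sum (ψ a)) ≤ q * (2 * sum φ)
    sum-ψ = begin
      sum (λ a → sum (ψ a))              ≡⟨ ∑-comm ψ ⟩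
      sum (λ c → sum (λ a → ψ a c))      ≡⟨ sum-cong-≗ (λ c → trans
                                              (sym (*-distribˡ-sum (φ c) (λ a → q ^ same a (code c zero))))
                                              (trans (cong (φ c *_) (sum-^-same r (code c zero))) (*-comm (φ c) (r + q)))) ⟩
      sum (λ c → (r + q) * φ c)          ≡⟨ *-distribˡ-sum (r + q) φ ⟨
      (r + q) * sum φ                    ≤⟨ *-monoˡ-≤ (sum φ) (+-monoˡ-≤ q (n≤1+n r)) ⟩
      (q + q) * sum φ                    ≡⟨ solve 2 (λ q s → (q :+ q) :* s := q :* (con 2 :* s)) refl q (sum φ) ⟩
      q * (2 * sum φ)                    ∎
      where open +-*-Solver

    letter = below-average q (λ a → sum (ψ a)) (2 * sum φ) sum-ψ
    a = proj₁ letter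
    -- The weights φ are arbitrary so that the letter just chosen can be absorbed: `ψ a` is the
    -- weight function for the remaining places.
    tail-word = avoiding-word ℓ q (ψ a) (λ c → code c ∘ suc)
    x = proj₁ tail-word

  Separated : ∀ {ℓ m} → (Fin m → Fin ℓ → Fin 16) → Set
  Separated {ℓ} code = ∀ {i j} → i ≢ j → 2 * agreement (code i) (code j) ≤ ℓ

  -- Greedy choice: the new word keeps the sum of 16 ^ agreement over the m earlier words at most 2
  -- ^ ℓ * m, so every single term obeys this bound. Since 16 = 2 ^ 4 and m < 2 ^ (ℓ + 1), an
  -- agreement a satisfies 4a < 2ℓ + 1.
  separated-code : ∀ ℓ m → m ≤ 2 ^ suc ℓ → ∃ λ (code : Fin m → Fin ℓ → Fin 16) → Separated code
  separated-code ℓ zero    _     = (λ ()) , λ {}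
  separated-code ℓ (suc m) m<2^ with separated-code ℓ m (<⇒≤ m<2^)
  ... | code , sep with avoiding-word ℓ 16 (λ _ → 1) code
  ...   | x , potential≤ = (x ∷ code) , separated
    where
    16^≤ : ∀ c → 16 ^ agreement x (code c) ≤ 2 ^ ℓ * m
    16^≤ c = begin
      16 ^ agreement x (code c)                        ≡⟨ *-identityˡ _ ⟨
      1 * 16 ^ agreement x (code c)                    ≤⟨ ≤-sum (λ c → 1 * 16 ^ agreement x (code c)) c ⟩
      sum (λ c → 1 * 16 ^ agreement x (code c))        ≤⟨ potential≤ ⟩
      2 ^ ℓ * sum {m} (λ _ → 1)                        ≡⟨ cong (2 ^ ℓ *_) (trans (sum-const m 1) (*-identityʳ m)) ⟩
      2 ^ ℓ * m                                        ∎
      where open ≤-Reasoning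

    far : ∀ c → 2 * agreement x (code c) ≤ ℓ
    -- Comparing exponents gives 4a < 2ℓ + 1; by integrality 4a ≤ 2ℓ, and the off-by-one in the size
    -- of the code is lost without cost.
    far c = *-cancelˡ-≤ 2 (s≤s⁻¹ (^-cancelʳ-< 2 (s≤s (s≤s z≤n)) (begin-strict
      2 ^ (2 * (2 * agreement x (code c)))   ≡⟨ cong (2 ^_) (*-assoc 2 2 (agreement x (code c))) ⟨
      2 ^ (4 * agreement x (code c))         ≡⟨ ^-*-assoc 2 4 (agreement x (code c)) ⟨
      16 ^ agreement x (code c)              ≤⟨ 16^≤ c ⟩
      2 ^ ℓ * m                              <⟨ *-monoʳ-< (2 ^ ℓ) {{m^n≢0 2 ℓ}} m<2^ ⟩
      2 ^ ℓ * 2 ^ suc ℓ                      ≡⟨ ^-distribˡ-+-* 2 ℓ (suc ℓ) ⟨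
      2 ^ (ℓ + suc ℓ)                        ≡⟨ cong (2 ^_) (+-suc ℓ ℓ) ⟩
      2 ^ suc (ℓ + ℓ)                        ≡⟨ cong (λ k → 2 ^ suc (ℓ + k)) (+-identityʳ ℓ) ⟨
      2 ^ suc (2 * ℓ)                        ∎)))
      where
      open ≤-Reasoning
      ^-cancelʳ-< : ∀ b → 1 < b → ∀ {i j} → b ^ i < b ^ j → i < j
      ^-cancelʳ-< b@(suc _) 1<b {i} {j} lt with i <? j
      ... | yes i<j = i<j
      ... | no  i≮j = contradiction (^-monoʳ-≤ b (≮⇒≥ i≮j)) (<⇒≱ lt)

    separated : Separated (x ∷ code)
    separated {zero}  {zero}  i≢j = contradiction refl i≢j
    separated {zero}  {suc j} _   = far j
    separated {suc i} {zero}  _   = subst (λ k → 2 * k ≤ ℓ) (agreement-sym x (code i)) (far i)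
    separated {suc i} {suc j} i≢j = sep (i≢j ∘ cong suc)

-- Fourier coefficients and size of Riesz products on the cube.

module RieszProducts where
  open import Data.Bool.Base using (Bool; true; false)
  open import Data.Fin.Base using (Fin; zero; suc; combine; remQuot)
  open import Data.Fin.Properties using (remQuot-combine)
  open import Data.Integer.Base as ℤ using ()
  open import Data.Nat.Base as ℕ using (ℕ; zero; suc)
  open import Data.Product.Base using (_×_; _,_; proj₁; proj₂)
  open import Data.Rational.Base using (ℚ; 0ℚ; 1ℚ; -_; _+_; _-_; _*_; _/_; _≤_; ½; nonNegative)
  open import Data.Rational.Properties
  open import Data.Rational.Solver using (module +-*-Solver)
  open import Data.Vec.Base using (Vec; []; _∷_; lookup)
  open import Function.Base using (_∘_)
  open import Relation.Binary.PropositionalEquality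
  open import Relation.Nullary using (yes; no; contradiction)
  open +-*-Solver
  open RationalSums

  ¼ : ℚ
  ¼ = ℤ.+ 1 / 4

  sign : Bool → ℚ
  sign true  = 1ℚ
  sign false = - 1ℚ

  -- Recursion on the first coordinate matches the recursion of `re` and `im`; `sumFin-bits`
  -- translates back to sums over vertices.
  cubeSum : ∀ ℓ → (Vec Bool ℓ → ℚ) → ℚ
  cubeSum zero    f = f []
  cubeSum (suc ℓ) f = cubeSum ℓ (λ y → f (true ∷ y)) + cubeSum ℓ (λ y → f (false ∷ y))

  cubeSum-cong : ∀ ℓ {f g : Vec Bool ℓ → ℚ} → (∀ y → f y ≡ g y) → cubeSum ℓ f ≡ cubeSum ℓ g
  cubeSum-cong zero    f≗g = f≗g []
  cubeSum-cong (suc ℓ) f≗g = cong₂ _+_ (cubeSum-cong ℓ (λ y → f≗g (true ∷ y))) (cubeSum-cong ℓ (λ y → f≗g (false ∷ y)))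

  cubeSum-+ : ∀ ℓ (f g : Vec Bool ℓ → ℚ) → cubeSum ℓ (λ y → f y + g y) ≡ cubeSum ℓ f + cubeSum ℓ g
  cubeSum-+ zero    f g = refl
  cubeSum-+ (suc ℓ) f g = trans
    (cong₂ _+_ (cubeSum-+ ℓ (λ y → f (true ∷ y)) (λ y → g (true ∷ y)))
               (cubeSum-+ ℓ (λ y → f (false ∷ y)) (λ y → g (false ∷ y))))
    (interchange (cubeSum ℓ (λ y → f (true ∷ y))) (cubeSum ℓ (λ y → g (true ∷ y))) _ _)

  *-distribˡ-cubeSum : ∀ ℓ c (f : Vec Bool ℓ → ℚ) → c * cubeSum ℓ f ≡ cubeSum ℓ (λ y → c * f y)
  *-distribˡ-cubeSum zero    c f = refl
  *-distribˡ-cubeSum (suc ℓ) c f = trans (*-distribˡ-+ c _ _)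
    (cong₂ _+_ (*-distribˡ-cubeSum ℓ c (λ y → f (true ∷ y))) (*-distribˡ-cubeSum ℓ c (λ y → f (false ∷ y))))

  cubeSum-zero : ∀ ℓ → cubeSum ℓ (λ _ → 0ℚ) ≡ 0ℚ
  cubeSum-zero ℓ = begin
    cubeSum ℓ (λ _ → 0ℚ)         ≡⟨ *-distribˡ-cubeSum ℓ 0ℚ (λ _ → 0ℚ) ⟨
    0ℚ * cubeSum ℓ (λ _ → 0ℚ)    ≡⟨ *-zeroˡ (cubeSum ℓ (λ _ → 0ℚ)) ⟩
    0ℚ                           ∎
    where open ≡-Reasoning

  bit : Fin 2 → Bool
  bit zero    = true
  bit (suc _) = false

  bits : ∀ ℓ → Fin (2 ℕ.^ ℓ) → Vec Bool ℓ
  bits zero    _ = []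
  bits (suc ℓ) i = bit (proj₁ (remQuot {2} (2 ℕ.^ ℓ) i)) ∷ bits ℓ (proj₂ (remQuot {2} (2 ℕ.^ ℓ) i))

  -- `bits` runs through the cube exactly once: `combine` and `remQuot` split an index of Fin (2 * 2
  -- ^ ℓ) into its leading digit and the rest.
  sumFin-bits : ∀ ℓ (f : Vec Bool ℓ → ℚ) → sumFin (2 ℕ.^ ℓ) (λ i → f (bits ℓ i)) ≡ cubeSum ℓ f
  sumFin-bits zero    f = +-identityʳ (f [])
  sumFin-bits (suc ℓ) f = begin
    sumFin (2 ℕ.^ suc ℓ) (λ i → f (bits (suc ℓ) i))
      ≡⟨ sumFin-combine 2 (2 ℕ.^ ℓ) (λ i → f (bits (suc ℓ) i)) ⟩
    sumFin 2 (λ b → sumFin (2 ℕ.^ ℓ) (λ i → f (bits (suc ℓ) (combine b i))))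
      ≡⟨ sumFin-cong 2 (λ b → trans
           (sumFin-cong (2 ℕ.^ ℓ) (λ i → cong (λ p → f (bit (proj₁ p) ∷ bits ℓ (proj₂ p))) (remQuot-combine b i)))
           (sumFin-bits ℓ (λ y → f (bit b ∷ y)))) ⟩
    cubeSum ℓ (λ y → f (true ∷ y)) + (cubeSum ℓ (λ y → f (false ∷ y)) + 0ℚ)
      ≡⟨ cong (cubeSum ℓ (λ y → f (true ∷ y)) +_) (+-identityʳ _) ⟩
    cubeSum (suc ℓ) f ∎
    where open ≡-Reasoning

  -- The real and imaginary parts of Π (1 + i βⱼ yⱼ).
  mutual
    re : ∀ {ℓ} → (Fin ℓ → ℚ) → Vec Bool ℓ → ℚ
    re β []      = 1ℚ
    re β (b ∷ y) = re (β ∘ suc) y - sign b * β zero * im (β ∘ suc) y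

    im : ∀ {ℓ} → (Fin ℓ → ℚ) → Vec Bool ℓ → ℚ
    im β []      = 0ℚ
    im β (b ∷ y) = im (β ∘ suc) y + sign b * β zero * re (β ∘ suc) y

  -- The two values of the first sign cancel the imaginary contribution and double the tail. In
  -- complex terms (1 + iβ) + (1 - iβ) = 2 for every factor.
  cubeSum-re : ∀ ℓ (β : Fin ℓ → ℚ) → cubeSum ℓ (re β) ≡ ℕ→ℚ (2 ℕ.^ ℓ)
  cubeSum-re zero    β = refl
  cubeSum-re (suc ℓ) β = begin
    cubeSum (suc ℓ) (re β)    ≡⟨ cubeSum-+ ℓ _ _ ⟨
    cubeSum ℓ (λ y → re β (true ∷ y) + re β (false ∷ y))
      ≡⟨ cubeSum-cong ℓ (λ y → solve 3 (λ r i b → r :- con 1ℚ :* b :* i :+ (r :- (:- con 1ℚ) :* b :* i) := con (ℕ→ℚ 2) :* r) refl (re β′ y) (im β′ y) (β zero)) ⟩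
    cubeSum ℓ (λ y → ℕ→ℚ 2 * re β′ y)  ≡⟨ *-distribˡ-cubeSum ℓ (ℕ→ℚ 2) (re β′) ⟨
    ℕ→ℚ 2 * cubeSum ℓ (re β′)          ≡⟨ cong (ℕ→ℚ 2 *_) (cubeSum-re ℓ β′) ⟩
    ℕ→ℚ 2 * ℕ→ℚ (2 ℕ.^ ℓ)              ≡⟨ ℕ→ℚ-* 2 (2 ℕ.^ ℓ) ⟨
    ℕ→ℚ (2 ℕ.^ suc ℓ)                  ∎
    where
    open ≡-Reasoning
    β′ = β ∘ suc

  cubeSum-sign : ∀ {ℓ} j → cubeSum ℓ (λ y → sign (lookup y j)) ≡ 0ℚ
  cubeSum-sign {suc ℓ} zero    = trans (sym (cubeSum-+ ℓ _ _)) (cubeSum-zero ℓ)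
  cubeSum-sign {suc ℓ} (suc j) = trans (cong₂ _+_ (cubeSum-sign j) (cubeSum-sign j)) (+-identityʳ 0ℚ)

  -- The degree-one Fourier coefficient. If j is the first coordinate, summing over its sign cancels
  -- `im` of the tail and leaves 2 β `re`, which `cubeSum-re` evaluates; otherwise the first sign
  -- averages out and the coefficient of the tail doubles.
  cubeSum-sign-im : ∀ {ℓ} (β : Fin ℓ → ℚ) j →
    cubeSum ℓ (λ y → sign (lookup y j) * im β y) ≡ ℕ→ℚ (2 ℕ.^ ℓ) * β j
  cubeSum-sign-im {suc ℓ} β zero = begin
    cubeSum (suc ℓ) (λ y → sign (lookup y zero) * im β y)    ≡⟨ cubeSum-+ ℓ _ _ ⟨
    cubeSum ℓ (λ y → 1ℚ * im β (true ∷ y) + - 1ℚ * im β (false ∷ y))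
      ≡⟨ cubeSum-cong ℓ (λ y → solve 3 (λ r i b → con 1ℚ :* (i :+ con 1ℚ :* b :* r) :+ (:- con 1ℚ) :* (i :+ (:- con 1ℚ) :* b :* r) := con (ℕ→ℚ 2) :* b :* r) refl (re β′ y) (im β′ y) (β zero)) ⟩
    cubeSum ℓ (λ y → ℕ→ℚ 2 * β zero * re β′ y)    ≡⟨ *-distribˡ-cubeSum ℓ (ℕ→ℚ 2 * β zero) (re β′) ⟨
    ℕ→ℚ 2 * β zero * cubeSum ℓ (re β′)            ≡⟨ cong (ℕ→ℚ 2 * β zero *_) (cubeSum-re ℓ β′) ⟩
    ℕ→ℚ 2 * β zero * ℕ→ℚ (2 ℕ.^ ℓ)                ≡⟨ solve 3 (λ a b c → a :* b :* c := a :* c :* b) refl (ℕ→ℚ 2) (β zero) (ℕ→ℚ (2 ℕ.^ ℓ)) ⟩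
    ℕ→ℚ 2 * ℕ→ℚ (2 ℕ.^ ℓ) * β zero                ≡⟨ cong (_* β zero) (ℕ→ℚ-* 2 (2 ℕ.^ ℓ)) ⟨
    ℕ→ℚ (2 ℕ.^ suc ℓ) * β zero                    ∎
    where
    open ≡-Reasoning
    β′ = β ∘ suc
  cubeSum-sign-im {suc ℓ} β (suc j) = begin
    cubeSum (suc ℓ) (λ y → sign (lookup y (suc j)) * im β y)    ≡⟨ cubeSum-+ ℓ _ _ ⟨
    cubeSum ℓ (λ y → sign (lookup y j) * im β (true ∷ y) + sign (lookup y j) * im β (false ∷ y))
      ≡⟨ cubeSum-cong ℓ (λ y → solve 4 (λ s r i b → s :* (i :+ con 1ℚ :* b :* r) :+ s :* (i :+ (:- con 1ℚ) :* b :* r) := con (ℕ→ℚ 2) :* (s :* i)) refl (sign (lookup y j)) (re β′ y) (im β′ y) (β zero)) ⟩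
    cubeSum ℓ (λ y → ℕ→ℚ 2 * (sign (lookup y j) * im β′ y))    ≡⟨ *-distribˡ-cubeSum ℓ (ℕ→ℚ 2) _ ⟨
    ℕ→ℚ 2 * cubeSum ℓ (λ y → sign (lookup y j) * im β′ y)      ≡⟨ cong (ℕ→ℚ 2 *_) (cubeSum-sign-im β′ j) ⟩
    ℕ→ℚ 2 * (ℕ→ℚ (2 ℕ.^ ℓ) * β (suc j))                        ≡⟨ *-assoc (ℕ→ℚ 2) (ℕ→ℚ (2 ℕ.^ ℓ)) (β (suc j)) ⟨
    ℕ→ℚ 2 * ℕ→ℚ (2 ℕ.^ ℓ) * β (suc j)                          ≡⟨ cong (_* β (suc j)) (ℕ→ℚ-* 2 (2 ℕ.^ ℓ)) ⟨
    ℕ→ℚ (2 ℕ.^ suc ℓ) * β (suc j)                              ∎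
    where
    open ≡-Reasoning
    β′ = β ∘ suc


  norm² : ∀ {ℓ} → (Fin ℓ → ℚ) → Vec Bool ℓ → ℚ
  norm² β y = re β y * re β y + im β y * im β y

  -- Multiplicativity of the modulus: the factors 1 + iβ and 1 - iβ both have squared modulus 1 +
  -- β².
  norm²-∷ : ∀ {ℓ} (β : Fin (suc ℓ) → ℚ) b y →
    norm² β (b ∷ y) ≡ (1ℚ + β zero * β zero) * norm² (β ∘ suc) y
  norm²-∷ β true  y = solve 3 (λ r i b →
    (r :- con 1ℚ :* b :* i) :* (r :- con 1ℚ :* b :* i) :+ (i :+ con 1ℚ :* b :* r) :* (i :+ con 1ℚ :* b :* r)
      := (con 1ℚ :+ b :* b) :* (r :* r :+ i :* i)) refl (re (β ∘ suc) y) (im (β ∘ suc) y) (β zero)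
  norm²-∷ β false y = solve 3 (λ r i b →
    (r :- (:- con 1ℚ) :* b :* i) :* (r :- (:- con 1ℚ) :* b :* i) :+ (i :+ (:- con 1ℚ) :* b :* r) :* (i :+ (:- con 1ℚ) :* b :* r)
      := (con 1ℚ :+ b :* b) :* (r :* r :+ i :* i)) refl (re (β ∘ suc) y) (im (β ∘ suc) y) (β zero)

  -- The squared modulus is at most (1 + t) ^ ℓ. While 2ℓt ≤ 1 this is at most 1 + 2ℓt, a linear
  -- bound that takes the place of the exponential.
  norm²-≤ : ∀ {t} → 0ℚ ≤ t → ∀ {ℓ} (β : Fin ℓ → ℚ) → (∀ j → β j * β j ≤ t) →
    ℕ→ℚ ℓ * t + ℕ→ℚ ℓ * t ≤ 1ℚ → ∀ y → norm² β y ≤ 1ℚ + (ℕ→ℚ ℓ * t + ℕ→ℚ ℓ * t)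
  norm²-≤ {t} 0≤t {zero}  β β²≤t _   []      = ≤-reflexive (sym (cong (1ℚ +_) (cong₂ _+_ (*-zeroˡ t) (*-zeroˡ t))))
  norm²-≤ {t} 0≤t {suc ℓ} β β²≤t 2T′≤1 (b ∷ y) = begin
    norm² β (b ∷ y)                              ≡⟨ norm²-∷ β b y ⟩
    (1ℚ + β zero * β zero) * norm² (β ∘ suc) y   ≤⟨ *-monoʳ-≤-nonNeg (norm² (β ∘ suc) y) {{nonNegative 0≤norm²}} (+-monoʳ-≤ 1ℚ (β²≤t zero)) ⟩
    (1ℚ + t) * norm² (β ∘ suc) y                 ≤⟨ *-monoˡ-≤-nonNeg (1ℚ + t) {{nonNegative (+-mono-≤ (0≤p² 1ℚ) 0≤t)}} (norm²-≤ 0≤t (β ∘ suc) (β²≤t ∘ suc) 2T≤1 y) ⟩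
    (1ℚ + t) * (1ℚ + (T + T))                    ≡⟨ solve 2 (λ t T → (con 1ℚ :+ t) :* (con 1ℚ :+ (T :+ T)) := con 1ℚ :+ (T :+ T) :+ t :+ t :* (T :+ T)) refl t T ⟩
    -- The cross term t * 2T is at most t because 2T ≤ 1; it supplies the second t of the increment
    -- 2t.
    1ℚ + (T + T) + t + t * (T + T)               ≤⟨ +-monoʳ-≤ (1ℚ + (T + T) + t) (*-monoˡ-≤-nonNeg t {{nonNegative 0≤t}} 2T≤1) ⟩
    1ℚ + (T + T) + t + t * 1ℚ                    ≡⟨ solve 2 (λ t T → con 1ℚ :+ (T :+ T) :+ t :+ t :* con 1ℚ := con 1ℚ :+ (t :+ T :+ (t :+ T))) refl t T ⟩
    1ℚ + (t + T + (t + T))                       ≡⟨ cong (λ s → 1ℚ + (s + s)) T′≡ ⟨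
    1ℚ + (T′ + T′)                               ∎
    where
    open ≤-Reasoning
    T = ℕ→ℚ ℓ * t
    T′ = ℕ→ℚ (suc ℓ) * t

    T′≡ : T′ ≡ t + T
    T′≡ = trans (cong (_* t) (ℕ→ℚ-+ 1 ℓ)) (trans (*-distribʳ-+ t 1ℚ (ℕ→ℚ ℓ)) (cong (_+ T) (*-identityˡ t)))

    T≤T′ : T ≤ T′
    T≤T′ = begin
      T        ≡⟨ +-identityˡ T ⟨
      0ℚ + T   ≤⟨ +-monoˡ-≤ T 0≤t ⟩
      t + T    ≡⟨ T′≡ ⟨
      T′       ∎

    2T≤1 : T + T ≤ 1ℚ
    2T≤1 = ≤-trans (+-mono-≤ T≤T′ T≤T′) 2T′≤1

    0≤norm² : 0ℚ ≤ norm² (β ∘ suc) y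
    0≤norm² = +-mono-≤ (0≤p² (re (β ∘ suc) y)) (0≤p² (im (β ∘ suc) y))

  p²≤4⇒p≤2 : ∀ p → p * p ≤ ℕ→ℚ 4 → p ≤ ℕ→ℚ 2
  p²≤4⇒p≤2 p p²≤4 with p ≤? ℕ→ℚ 2
  ... | yes p≤2 = p≤2
  ... | no  p≰2 = contradiction p²≤4 (<⇒≱ (begin-strict
    ℕ→ℚ 2 * ℕ→ℚ 2   <⟨ *-monoˡ-<-pos (ℕ→ℚ 2) (≰⇒> p≰2) ⟩
    p * ℕ→ℚ 2       ≤⟨ *-monoˡ-≤-nonNeg p {{nonNegative (≤-trans (0≤p² 1ℚ) (≤-trans 1≤2 (<⇒≤ (≰⇒> p≰2))))}} (<⇒≤ (≰⇒> p≰2)) ⟩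
    p * p           ∎))
    where
    open ≤-Reasoning
    1≤2 : 1ℚ ≤ ℕ→ℚ 2
    1≤2 = ℕ→ℚ-mono-≤ {1} {2} (ℕ.s≤s ℕ.z≤n)

  weight : ∀ {ℓ} → (Fin ℓ → ℚ) → Vec Bool ℓ → ℚ
  weight β y = ½ + ¼ * im β y

  -- The imaginary part is bounded by the modulus, hence by 2 in absolute value, and the factor ¼
  -- turns this into a deviation of at most ½ from ½.
  weight-∈[0,1] : ∀ {t} → 0ℚ ≤ t → ∀ {ℓ} (β : Fin ℓ → ℚ) → (∀ j → β j * β j ≤ t) →
    ℕ→ℚ ℓ * t + ℕ→ℚ ℓ * t ≤ 1ℚ → ∀ y → 0ℚ ≤ weight β y × weight β y ≤ 1ℚ
  weight-∈[0,1] {t} 0≤t {ℓ} β β²≤t 2T≤1 y =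
    (begin
      0ℚ                        ≤⟨ +-monoʳ-≤ ½ (*-monoˡ-≤-nonNeg ¼ (neg-antimono-≤ -im≤2)) ⟩
      ½ + ¼ * - - im β y  ≡⟨ cong (λ s → ½ + ¼ * s) (solve 1 (λ i → :- (:- i) := i) refl (im β y)) ⟩
      weight β y                ∎) ,
    +-monoʳ-≤ ½ (*-monoˡ-≤-nonNeg ¼ im≤2)
    where
    open ≤-Reasoning
    T = ℕ→ℚ ℓ * t
    im²≤4 : im β y * im β y ≤ ℕ→ℚ 4
    im²≤4 = begin
      im β y * im β y                   ≡⟨ +-identityˡ (im β y * im β y) ⟨
      0ℚ + im β y * im β y              ≤⟨ +-monoˡ-≤ (im β y * im β y) (0≤p² (re β y)) ⟩
      norm² β y                         ≤⟨ norm²-≤ 0≤t β β²≤t 2T≤1 y ⟩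
      1ℚ + (T + T)                      ≤⟨ +-monoʳ-≤ 1ℚ 2T≤1 ⟩
      -- The bound 2 on the square is relaxed to 4, which has a rational square root.
      ℕ→ℚ 2                             ≤⟨ ℕ→ℚ-mono-≤ {2} {4} (ℕ.s≤s (ℕ.s≤s ℕ.z≤n)) ⟩
      ℕ→ℚ 4                             ∎

    im≤2 : im β y ≤ ℕ→ℚ 2
    im≤2 = p²≤4⇒p≤2 (im β y) im²≤4

    -im≤2 : - im β y ≤ ℕ→ℚ 2
    -im≤2 = p²≤4⇒p≤2 (- im β y) (≤-trans (≤-reflexive (solve 1 (λ i → (:- i) :* (:- i) := i :* i) refl (im β y))) im²≤4)

  -- The constant ½ is orthogonal to every coordinate, so only the linear coefficient survives.
  cubeSum-sign-weight : ∀ {ℓ} (β : Fin ℓ → ℚ) j →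
    cubeSum ℓ (λ y → sign (lookup y j) * weight β y) ≡ ¼ * (ℕ→ℚ (2 ℕ.^ ℓ) * β j)
  cubeSum-sign-weight {ℓ} β j = begin
    cubeSum ℓ (λ y → σ y * weight β y)
      ≡⟨ cubeSum-cong ℓ (λ y → solve 2 (λ s i → s :* (con ½ :+ con ¼ :* i) := con ½ :* s :+ con ¼ :* (s :* i)) refl (σ y) (im β y)) ⟩
    cubeSum ℓ (λ y → ½ * σ y + ¼ * (σ y * im β y))
      ≡⟨ cubeSum-+ ℓ _ _ ⟩
    cubeSum ℓ (λ y → ½ * σ y) + cubeSum ℓ (λ y → ¼ * (σ y * im β y))
      ≡⟨ cong₂ _+_ (*-distribˡ-cubeSum ℓ ½ σ) (*-distribˡ-cubeSum ℓ ¼ (λ y → σ y * im β y)) ⟨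
    ½ * cubeSum ℓ σ + ¼ * cubeSum ℓ (λ y → σ y * im β y)
      ≡⟨ cong₂ (λ a b → ½ * a + ¼ * b) (cubeSum-sign j) (cubeSum-sign-im β j) ⟩
    ½ * 0ℚ + ¼ * (ℕ→ℚ (2 ℕ.^ ℓ) * β j)
      ≡⟨ +-identityˡ _ ⟩
    ¼ * (ℕ→ℚ (2 ℕ.^ ℓ) * β j) ∎
    where
    open ≡-Reasoning
    σ : Vec Bool ℓ → ℚ
    σ y = sign (lookup y j)

-- From weak regularity to degree estimates, and sums over the parts of a partition.

module PartitionSums where
  open import Data.Bool.Base using (Bool; true; false; not; if_then_else_)
  open import Data.Fin.Base using (Fin; zero; suc)
  open import Data.Fin.Properties using (_≟_)
  open import Data.Fin.Subset using (Subset; _∩_) renaming (∣_∣ to card)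
  open import Data.Nat.Base as ℕ using (ℕ; zero; suc)
  open import Data.Rational.Base using (ℚ; 0ℚ; 1ℚ; -_; _+_; _-_; _*_; _≤_; ∣_∣)
  open import Data.Rational.Properties hiding (_≟_)
  open import Data.Rational.Solver using (module +-*-Solver)
  open import Data.Sum.Base using (inj₁; inj₂)
  open import Data.Vec.Base using ([]; _∷_; tabulate)
  open import Data.Vec.Properties using (lookup∘tabulate)
  open import Function.Base using (_∘_)
  open import Relation.Binary.PropositionalEquality
  open import Relation.Nullary using (yes; no; Dec; contradiction)
  open import Relation.Nullary.Decidable using (⌊_⌋; does)
  open RationalSums

  χ : Bool → ℚ
  χ b = if b then 1ℚ else 0ℚ

  card≡sumFin : ∀ {n} (A : Subset n) → ℕ→ℚ (card A) ≡ sumFin n (indicator A)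
  card≡sumFin []          = refl
  card≡sumFin (true  ∷ A) = trans (ℕ→ℚ-+ 1 (card A)) (cong (1ℚ +_) (card≡sumFin A))
  card≡sumFin (false ∷ A) = trans (card≡sumFin A) (sym (+-identityˡ _))

  indicator-∩ : ∀ {n} (A B : Subset n) x → indicator (A ∩ B) x ≡ indicator A x * indicator B x
  indicator-∩ (true  ∷ A) (b ∷ B) zero    = sym (*-identityˡ (χ b))
  indicator-∩ (false ∷ A) (b ∷ B) zero    = sym (*-zeroˡ (χ b))
  indicator-∩ (a ∷ A)     (b ∷ B) (suc x) = indicator-∩ A B x

  indicator-tabulate : ∀ {n} (f : Fin n → Bool) x → indicator (tabulate f) x ≡ χ (f x)
  indicator-tabulate f x = cong χ (lookup∘tabulate f x)

  -- Double counting: each vertex of A lies in exactly one part and picks up the value of g there.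
  sumFin-card-part : ∀ {n k} (P : Partition n k) (g : Fin k → ℚ) A →
    sumFin k (λ i → g i * ℕ→ℚ (card (part P i ∩ A))) ≡ sumFin n (λ u → indicator A u * g (P u))
  sumFin-card-part {n} {k} P g A = begin
    sumFin k (λ i → g i * ℕ→ℚ (card (part P i ∩ A)))
      ≡⟨ sumFin-cong k (λ i → trans
           (cong (g i *_) (trans (card≡sumFin (part P i ∩ A)) (sumFin-cong n (λ u →
             trans (indicator-∩ (part P i) A u) (cong (_* indicator A u) (indicator-tabulate _ u))))))
           (*-distribˡ-sumFin n (g i) (λ u → δ (P u) i * indicator A u))) ⟩
    sumFin k (λ i → sumFin n (λ u → g i * (δ (P u) i * indicator A u)))
      ≡⟨ sumFin-comm k n _ ⟩
    sumFin n (λ u → sumFin k (λ i → g i * (δ (P u) i * indicator A u)))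
      ≡⟨ sumFin-cong n (λ u → trans
           (sumFin-cong k (λ i → solve 3 (λ g d a → g :* (d :* a) := a :* (g :* d)) refl (g i) (δ (P u) i) (indicator A u)))
           (trans (sym (*-distribˡ-sumFin k (indicator A u) (λ i → g i * δ (P u) i)))
             (cong (indicator A u *_) (sumFin-δ g (P u))))) ⟩
    sumFin n (λ u → indicator A u * g (P u)) ∎
    where
    open ≡-Reasoning
    open +-*-Solver

  module _ {n k k'} (w : Weights n) (P₁ : Partition n k) (P₂ : Partition n k') where

    degree : Subset n → Fin n → ℚ
    degree B u = sumFin n (λ v → indicator B v * w u v)

    -- The degree into B of a vertex of part i after every weight is replaced by the density of its
    -- pair of parts. All vertices of one part share this value.
    partDegree : Subset n → Fin k → ℚ
    partDegree B i = sumFin k' (λ j → d-w w (part P₁ i) (part P₂ j) * ℕ→ℚ (card (part P₂ j ∩ B)))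

    -- With B fixed, f is linear in the indicator of A. Freedom in choosing A then controls the
    -- absolute deviations of the degrees, not merely their sum.
    f-P≡ : ∀ A B → f-P w P₁ P₂ A B ≡
      sumFin n (λ u → indicator A u * (degree B u - partDegree B (P₁ u)))
    f-P≡ A B = begin
      f-P w P₁ P₂ A B
        ≡⟨ cong₂ _-_
             (sumFin-cong n (λ u → trans
               (sumFin-cong n (λ v → *-assoc (indicator A u) (indicator B v) (w u v)))
               (sym (*-distribˡ-sumFin n (indicator A u) (λ v → indicator B v * w u v)))))
             (trans
               (sumFin-cong k (λ i → trans
                 (sumFin-cong k' (λ j → solve 3 (λ d a b → d :* a :* b := d :* b :* a) refl
                   (d-w w (part P₁ i) (part P₂ j)) (ℕ→ℚ (card (part P₁ i ∩ A))) (ℕ→ℚ (card (part P₂ j ∩ B)))))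
                 (sym (*-distribʳ-sumFin k' (ℕ→ℚ (card (part P₁ i ∩ A))) _))))
               (sumFin-card-part P₁ (partDegree B) A)) ⟩
      sumFin n (λ u → indicator A u * degree B u) - sumFin n (λ u → indicator A u * partDegree B (P₁ u))
        ≡⟨ sumFin-- n _ _ ⟨
      sumFin n (λ u → indicator A u * degree B u - indicator A u * partDegree B (P₁ u))
        ≡⟨ sumFin-cong n (λ u → solve 3 (λ a d g → a :* d :- a :* g := a :* (d :- g)) refl
             (indicator A u) (degree B u) (partDegree B (P₁ u))) ⟩
      sumFin n (λ u → indicator A u * (degree B u - partDegree B (P₁ u))) ∎
      where
      open ≡-Reasoning
      open +-*-Solver

  p≤∣p∣ : ∀ p → p ≤ ∣ p ∣
  p≤∣p∣ p with ≤-total 0ℚ p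
  ... | inj₁ 0≤p = ≤-reflexive (sym (0≤p⇒∣p∣≡p 0≤p))
  ... | inj₂ p≤0 = ≤-trans p≤0 (0≤∣p∣ p)

  -- Phrased with the Boolean of the decision, so that the two coefficients become the indicators of
  -- the sets `A⁺` and `A⁻` of `sumFin-∣∣-≤`.
  ∣p∣≡ : ∀ p (d : Dec (0ℚ ≤ p)) → ∣ p ∣ ≡ χ (does d) * p - χ (not (does d)) * p
  ∣p∣≡ p (yes 0≤p) = trans (0≤p⇒∣p∣≡p 0≤p) (solve 1 (λ p → p := con 1ℚ :* p :- con 0ℚ :* p) refl p)
    where open +-*-Solver
  ∣p∣≡ p (no  0≰p) = trans (sym (∣-p∣≡∣p∣ p)) (trans (0≤p⇒∣p∣≡p (neg-antimono-≤ (<⇒≤ (≰⇒> 0≰p))))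
    (solve 1 (λ p → :- p := con 0ℚ :* p :- con 1ℚ :* p) refl p))
    where open +-*-Solver

  -- Test the bound on the set where h is nonnegative and on its complement: the sum of absolute
  -- values is the difference of the two tested sums.
  sumFin-∣∣-≤ : ∀ {n} (h : Fin n → ℚ) {c} → (∀ A → ∣ sumFin n (λ u → indicator A u * h u) ∣ ≤ c) →
    sumFin n (λ u → ∣ h u ∣) ≤ c + c
  sumFin-∣∣-≤ {n} h {c} bound = begin
    sumFin n (λ u → ∣ h u ∣)                                      ≡⟨ sumFin-cong n ∣h∣≡ ⟩
    sumFin n (λ u → indicator A⁺ u * h u - indicator A⁻ u * h u)  ≡⟨ sumFin-- n _ _ ⟩
    S⁺ - S⁻                                                       ≤⟨ p≤∣p∣ (S⁺ - S⁻) ⟩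
    ∣ S⁺ - S⁻ ∣                                                   ≤⟨ ∣p-q∣≤∣p∣+∣q∣ S⁺ S⁻ ⟩
    ∣ S⁺ ∣ + ∣ S⁻ ∣                                               ≤⟨ +-mono-≤ (bound A⁺) (bound A⁻) ⟩
    c + c                                                         ∎
    where
    open ≤-Reasoning
    A⁺ A⁻ : Subset n
    A⁺ = tabulate (λ u → does (0ℚ ≤? h u))
    A⁻ = tabulate (λ u → not (does (0ℚ ≤? h u)))
    S⁺ = sumFin n (λ u → indicator A⁺ u * h u)
    S⁻ = sumFin n (λ u → indicator A⁻ u * h u)

    ∣h∣≡ : ∀ u → ∣ h u ∣ ≡ indicator A⁺ u * h u - indicator A⁻ u * h u
    ∣h∣≡ u = trans (∣p∣≡ (h u) (0ℚ ≤? h u)) (sym (cong₂ (λ a b → a * h u - b * h u)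
      (indicator-tabulate (λ u → does (0ℚ ≤? h u)) u)
      (indicator-tabulate (λ u → not (does (0ℚ ≤? h u))) u)))

  module _ {n k k'} {ε} (w : Weights n) (P₁ : Partition n k) (P₂ : Partition n k')
           (regular : WeakRegular ε w P₁ P₂) (B⁺ B⁻ : Subset n) where

    private c = ε * ℕ→ℚ (n ℕ.* n)

    degree-approx : ∀ B → sumFin n (λ u → ∣ degree w P₁ P₂ B u - partDegree w P₁ P₂ B (P₁ u) ∣) ≤ c + c
    degree-approx B = sumFin-∣∣-≤ _ (λ A → subst (λ s → ∣ s ∣ ≤ c) (f-P≡ w P₁ P₂ A B) (regular A B))

    -- Regularity speaks of sets, whereas a coordinate of the cube is a signed function. It is a
    -- difference of two indicators, each of which costs 2c, where c = ε n².
    signed-degree-approx :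
      sumFin n (λ u → ∣ sumFin n (λ v → (indicator B⁺ v - indicator B⁻ v) * w u v)
                      - (partDegree w P₁ P₂ B⁺ (P₁ u) - partDegree w P₁ P₂ B⁻ (P₁ u)) ∣)
      ≤ (c + c) + (c + c)
    signed-degree-approx = begin
      sumFin n (λ u → ∣ sumFin n (λ v → (indicator B⁺ v - indicator B⁻ v) * w u v) - (g B⁺ u - g B⁻ u) ∣)
        ≤⟨ sumFin-mono-≤ n (λ u → ≤-trans (≤-reflexive (cong ∣_∣ (split u))) (∣p-q∣≤∣p∣+∣q∣ (h B⁺ u) (h B⁻ u))) ⟩
      sumFin n (λ u → ∣ h B⁺ u ∣ + ∣ h B⁻ u ∣)                       ≡⟨ sumFin-+ n _ _ ⟩
      sumFin n (λ u → ∣ h B⁺ u ∣) + sumFin n (λ u → ∣ h B⁻ u ∣)      ≤⟨ +-mono-≤ (degree-approx B⁺) (degree-approx B⁻) ⟩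
      (c + c) + (c + c)                                              ∎
      where
      open ≤-Reasoning
      g h : Subset n → Fin n → ℚ
      g B u = partDegree w P₁ P₂ B (P₁ u)
      h B u = degree w P₁ P₂ B u - g B u

      split : ∀ u → sumFin n (λ v → (indicator B⁺ v - indicator B⁻ v) * w u v) - (g B⁺ u - g B⁻ u) ≡ h B⁺ u - h B⁻ u
      split u = trans
        (cong (_- (g B⁺ u - g B⁻ u)) (trans
          (sumFin-cong n (λ v → solve 3 (λ a b w → (a :- b) :* w := a :* w :- b :* w) refl (indicator B⁺ v) (indicator B⁻ v) (w u v)))
          (sumFin-- n _ _)))
        (solve 4 (λ a b c d → a :- b :- (c :- d) := a :- c :- (b :- d)) refl
          (degree w P₁ P₂ B⁺ u) (degree w P₁ P₂ B⁻ u) (g B⁺ u) (g B⁻ u))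
        where open +-*-Solver

  module _ {t} (0≤t : 0ℚ ≤ t) where
    -- A marked vertex with D < t is unique; it costs the extra term t.
    marked-sum : ∀ {n} (D : Fin n → ℚ) (M : Fin n → Bool) → (∀ u → 0ℚ ≤ D u) →
      (∀ {u v} → u ≢ v → M u ≡ true → M v ≡ true → t + t ≤ D u + D v) →
      sumFin n (λ u → t * χ (M u)) ≤ sumFin n (λ u → D u * χ (M u)) + t
    marked-sum {zero}  D M 0≤D sep = ≤-trans 0≤t (≤-reflexive (sym (+-identityˡ t)))
    marked-sum {suc n} D M 0≤D sep with M zero in M0≡
    ... | false = begin
      t * 0ℚ + T          ≡⟨ cong (_+ T) (trans (*-zeroʳ t) (sym (*-zeroʳ (D zero)))) ⟩
      D zero * 0ℚ + T     ≤⟨ +-monoʳ-≤ (D zero * 0ℚ) (marked-sum (D ∘ suc) (M ∘ suc) (0≤D ∘ suc) sep′) ⟩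
      D zero * 0ℚ + (S + t)  ≡⟨ +-assoc (D zero * 0ℚ) S t ⟨
      D zero * 0ℚ + S + t    ∎
      where
      open ≤-Reasoning
      T = sumFin n (λ u → t * χ (M (suc u)))
      S = sumFin n (λ u → D (suc u) * χ (M (suc u)))
      sep′ : ∀ {u v} → u ≢ v → M (suc u) ≡ true → M (suc v) ≡ true → t + t ≤ D (suc u) + D (suc v)
      sep′ u≢v = sep (λ { refl → u≢v refl })
    ... | true with t ≤? D zero
    ...   | yes t≤D = begin
      t * 1ℚ + T               ≤⟨ +-mono-≤ (*-monoʳ-≤-nonNeg 1ℚ t≤D) (marked-sum (D ∘ suc) (M ∘ suc) (0≤D ∘ suc) sep′) ⟩
      D zero * 1ℚ + (S + t)    ≡⟨ +-assoc (D zero * 1ℚ) S t ⟨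
      D zero * 1ℚ + S + t      ∎
      where
      open ≤-Reasoning
      T = sumFin n (λ u → t * χ (M (suc u)))
      S = sumFin n (λ u → D (suc u) * χ (M (suc u)))
      sep′ : ∀ {u v} → u ≢ v → M (suc u) ≡ true → M (suc v) ≡ true → t + t ≤ D (suc u) + D (suc v)
      sep′ u≢v = sep (λ { refl → u≢v refl })
    -- The first vertex is the exceptional one. Another marked vertex with `D` below t would
    -- contradict `sep`, so all the others pay for themselves and the extra t covers the first.
    ...   | no  t≰D = begin
      t * 1ℚ + T               ≡⟨ cong (_+ T) (*-identityʳ t) ⟩
      t + T                    ≤⟨ +-monoʳ-≤ t (sumFin-mono-≤ n others) ⟩
      t + S                    ≡⟨ +-comm t S ⟩
      S + t                    ≡⟨ cong (_+ t) (+-identityˡ S) ⟨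
      0ℚ + S + t               ≤⟨ +-monoˡ-≤ t (+-monoˡ-≤ S (≤-trans (0≤D zero) (≤-reflexive (sym (*-identityʳ (D zero)))))) ⟩
      D zero * 1ℚ + S + t      ∎
      where
      open ≤-Reasoning
      T = sumFin n (λ u → t * χ (M (suc u)))
      S = sumFin n (λ u → D (suc u) * χ (M (suc u)))
      others : ∀ u → t * χ (M (suc u)) ≤ D (suc u) * χ (M (suc u))
      others u with M (suc u) in Mu≡
      ... | false = ≤-reflexive (trans (*-zeroʳ t) (sym (*-zeroʳ (D (suc u)))))
      ... | true  with t ≤? D (suc u)
      ...   | yes t≤Du = *-monoʳ-≤-nonNeg 1ℚ t≤Du
      ...   | no  t≰Du = contradiction (sep (λ ()) M0≡ Mu≡) (<⇒≱ (+-mono-< (≰⇒> t≰D) (≰⇒> t≰Du)))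

    -- In each part at most one vertex has `D` below t, so at most k vertices in total fall short.
    -- Written additively to avoid the difference n - k.
    separated-sum : ∀ {n k} (D : Fin n → ℚ) (P : Partition n k) → (∀ u → 0ℚ ≤ D u) →
      (∀ {u v} → u ≢ v → P u ≡ P v → t + t ≤ D u + D v) →
      ℕ→ℚ n * t ≤ sumFin n D + ℕ→ℚ k * t
    separated-sum {n} {k} D P 0≤D sep = begin
      ℕ→ℚ n * t                                           ≡⟨ sumFin-const n t ⟨
      sumFin n (λ _ → t)                                  ≡⟨ by-part (λ _ → t) ⟩
      sumFin k (λ i → sumFin n (λ u → t * δ (P u) i))     ≤⟨ sumFin-mono-≤ k (λ i → marked-sum D (λ u → ⌊ P u ≟ i ⌋) 0≤D
                                                               (λ {u} {v} u≢v Pu Pv → sep u≢v (trans (marked u Pu) (sym (marked v Pv))))) ⟩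
      sumFin k (λ i → sumFin n (λ u → D u * δ (P u) i) + t)   ≡⟨ sumFin-+ k _ (λ _ → t) ⟩
      sumFin k (λ i → sumFin n (λ u → D u * δ (P u) i)) + sumFin k (λ _ → t)
                                                          ≡⟨ cong₂ _+_ (by-part D) (sym (sumFin-const k t)) ⟨
      sumFin n D + ℕ→ℚ k * t                              ∎
      where
      open ≤-Reasoning
      by-part : ∀ (f : Fin n → ℚ) → sumFin n f ≡ sumFin k (λ i → sumFin n (λ u → f u * δ (P u) i))
      by-part f = trans (sumFin-cong n (λ u → sym (sumFin-δ (λ _ → f u) (P u)))) (sumFin-comm n k _)

      marked : ∀ u {i} → ⌊ P u ≟ i ⌋ ≡ true → P u ≡ i
      marked u {i} eq with P u ≟ i
      marked u {i} eq | yes Pu≡i = Pu≡i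
      marked u {i} () | no  _

-- The weighted graph, and the inequality that a regular partition would force on it.

module LowerBound where
  open import Data.Bool.Base using (Bool; true; false; not)
  open import Data.Fin.Base using (Fin; zero; suc; toℕ; splitAt; _↑ˡ_; _↑ʳ_)
  open import Data.Fin.Properties using (_≟_; toℕ<n; toℕ-injective; splitAt-↑ˡ; splitAt-↑ʳ)
  open import Data.Fin.Subset using (Subset)
  open import Data.Integer.Base as ℤ using ()
  import Data.Integer.Properties as ℤ
  open import Data.Nat.Base as ℕ using (ℕ; zero; suc; z≤n; s≤s)
  import Data.Nat.Properties as ℕ
  open import Data.Product.Base using (_,_)
  open import Data.Rational.Base using (ℚ; mkℚ; 0ℚ; 1ℚ; ½; _+_; _-_; -_; _*_; _≤_; _<_; *<*; *≤*; ∣_∣; nonNegative; positive; toℚᵘ)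
  open import Data.Rational.Properties hiding (_≟_)
  open import Data.Rational.Solver using (module +-*-Solver)
  open import Data.Rational.Unnormalised.Base as ℚᵘ using (mkℚᵘ; *≡*)
  import Data.Rational.Unnormalised.Properties as ℚᵘ
  open import Data.Sum.Base using (inj₁; inj₂; [_,_]′)
  open import Data.Vec.Base using (Vec; lookup; tabulate)
  open import Function.Base using (_∘_)
  open import Relation.Binary.Definitions using (tri<; tri≈; tri>)
  open import Relation.Binary.PropositionalEquality
  open import Relation.Nullary using (yes; no; ¬_; contradiction)
  open RationalSums
  open Codes
  open RieszProducts
  open PartitionSums

  0≤ℕ→ℚ : ∀ m → 0ℚ ≤ ℕ→ℚ m
  0≤ℕ→ℚ m = ℕ→ℚ-mono-≤ {0} {m} z≤n

  0<ℕ→ℚ : ∀ {m} → 0 ℕ.< m → 0ℚ < ℕ→ℚ m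
  0<ℕ→ℚ {m} 0<m = <-≤-trans (*<* (ℤ.+<+ (s≤s z≤n))) (ℕ→ℚ-mono-≤ {1} {m} 0<m)

  0<p*q : ∀ {p q} → 0ℚ < p → 0ℚ < q → 0ℚ < p * q
  0<p*q {p} {q} 0<p 0<q = ≤-<-trans (≤-reflexive (sym (*-zeroʳ p))) (*-monoʳ-<-pos p {{positive 0<p}} 0<q)

  ∣p-q∣≡∣q-p∣ : ∀ p q → ∣ p - q ∣ ≡ ∣ q - p ∣
  ∣p-q∣≡∣q-p∣ p q = trans (sym (∣-p∣≡∣p∣ (p - q))) (cong ∣_∣ (solve 2 (λ p q → :- (p :- q) := q :- p) refl p q))
    where open +-*-Solver

  ∣p-q∣≤∣p-r∣+∣q-r∣ : ∀ p q r → ∣ p - q ∣ ≤ ∣ p - r ∣ + ∣ q - r ∣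
  ∣p-q∣≤∣p-r∣+∣q-r∣ p q r = ≤-trans
    (≤-reflexive (cong ∣_∣ (solve 3 (λ p q r → p :- q := p :- r :- (q :- r)) refl p q r)))
    (∣p-q∣≤∣p∣+∣q∣ (p - r) (q - r))
    where open +-*-Solver

  p²-mono-≤ : ∀ {p q} → 0ℚ ≤ p → p ≤ q → p * p ≤ q * q
  p²-mono-≤ {p} {q} 0≤p p≤q = ≤-trans
    (*-monoˡ-≤-nonNeg p {{nonNegative 0≤p}} p≤q)
    (*-monoʳ-≤-nonNeg q {{nonNegative (≤-trans 0≤p p≤q)}} p≤q)

  -- Links ε to the natural numbers in which `IsFloorPow2` is phrased; positivity identifies the
  -- numerator with its absolute value.
  num≡ε*den : ∀ {ε} → 0ℚ < ε → ε * ℕ→ℚ (denε ε) ≡ ℕ→ℚ (numε ε)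
  num≡ε*den {ε@(mkℚ i d-1 _)} 0<ε = toℚᵘ-injective (begin
    toℚᵘ (ε * ℕ→ℚ (suc d-1))              ≈⟨ toℚᵘ-homo-* ε (ℕ→ℚ (suc d-1)) ⟩
    toℚᵘ ε ℚᵘ.* toℚᵘ (ℕ→ℚ (suc d-1))      ≈⟨ ℚᵘ.*-congˡ {toℚᵘ ε} (toℚᵘ-ℕ→ℚ (suc d-1)) ⟩
    toℚᵘ ε ℚᵘ.* mkℚᵘ (ℤ.+ suc d-1) 0      ≈⟨ *≡* cross ⟩
    mkℚᵘ (ℤ.+ ℤ.∣ i ∣) 0                  ≈⟨ toℚᵘ-ℕ→ℚ ℤ.∣ i ∣ ⟨
    toℚᵘ (ℕ→ℚ ℤ.∣ i ∣)                    ∎)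
    where
    open ℚᵘ.≃-Reasoning
    i≡ : ℤ.+ ℤ.∣ i ∣ ≡ i
    i≡ = ℤ.0≤i⇒+∣i∣≡i (ℤ.nonNegative⁻¹ i {{nonNegative (<⇒≤ 0<ε)}})

    cross : i ℤ.* ℤ.+ suc d-1 ℤ.* ℤ.+ 1 ≡ ℤ.+ ℤ.∣ i ∣ ℤ.* ℤ.+ (suc d-1 ℕ.* 1)
    cross = trans (ℤ.*-identityʳ _) (cong₂ (λ a b → a ℤ.* ℤ.+ b) (sym i≡) (sym (ℕ.*-identityʳ (suc d-1))))

  -- Letters become the numbers 0 to 15: distinct letters differ by at least 1, and all stay below
  -- the 16 that enters the bound on β².
  letter : Fin 16 → ℚ
  letter a = ℕ→ℚ (toℕ a)

  letter-gap-< : ∀ {K} → 0ℚ ≤ K → ∀ {a b} → toℕ b ℕ.< toℕ a → K * 1ℚ ≤ ∣ K * letter a - K * letter b ∣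
  letter-gap-< {K} 0≤K {a} {b} b<a = begin
    K * 1ℚ                               ≡⟨ solve 2 (λ K b → K :* con 1ℚ := K :* (con 1ℚ :+ b) :- K :* b) refl K (letter b) ⟩
    K * (1ℚ + letter b) - K * letter b   ≤⟨ +-monoˡ-≤ (- (K * letter b)) (*-monoˡ-≤-nonNeg K {{nonNegative 0≤K}} 1+b≤a) ⟩
    K * letter a - K * letter b          ≤⟨ p≤∣p∣ (K * letter a - K * letter b) ⟩
    ∣ K * letter a - K * letter b ∣      ∎
    where
    open ≤-Reasoning
    open +-*-Solver
    1+b≤a : 1ℚ + letter b ≤ letter a
    1+b≤a = ≤-trans (≤-reflexive (sym (ℕ→ℚ-+ 1 (toℕ b)))) (ℕ→ℚ-mono-≤ b<a)

  letter-gap : ∀ {K} → 0ℚ ≤ K → ∀ a b → K * (1ℚ - ℕ→ℚ (same a b)) ≤ ∣ K * letter a - K * letter b ∣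
  letter-gap {K} 0≤K a b with a ≟ b
  ... | yes _   = ≤-trans (≤-reflexive (*-zeroʳ K)) (0≤∣p∣ (K * letter a - K * letter b))
  ... | no  a≢b with ℕ.<-cmp (toℕ a) (toℕ b)
  ...   | tri< a<b _ _ = ≤-trans (letter-gap-< 0≤K {b} {a} a<b) (≤-reflexive (∣p-q∣≡∣q-p∣ (K * letter b) (K * letter a)))
  ...   | tri≈ _ a≡b _ = contradiction (toℕ-injective a≡b) a≢b
  ...   | tri> _ _ b<a = letter-gap-< 0≤K {a} {b} b<a

  ℕ→ℚ-agreement : ∀ {ℓ} (x y : Fin ℓ → Fin 16) →
    ℕ→ℚ (agreement x y) ≡ sumFin ℓ (λ j → ℕ→ℚ (same (x j) (y j)))
  ℕ→ℚ-agreement {zero}  x y = refl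
  ℕ→ℚ-agreement {suc ℓ} x y = trans (ℕ→ℚ-+ (same (x zero) (y zero)) _)
    (cong (ℕ→ℚ (same (x zero) (y zero)) +_) (ℕ→ℚ-agreement (x ∘ suc) (y ∘ suc)))

  -- At least half of the ℓ places disagree, and each of these contributes at least K.
  far-apart : ∀ {K} → 0ℚ ≤ K → ∀ {ℓ} (x y : Fin ℓ → Fin 16) → 2 ℕ.* agreement x y ℕ.≤ ℓ →
    ½ * (K * ℕ→ℚ ℓ) ≤ sumFin ℓ (λ j → ∣ K * letter (x j) - K * letter (y j) ∣)
  far-apart {K} 0≤K {ℓ} x y 2a≤ℓ = begin
    ½ * (K * ℕ→ℚ ℓ)                        ≡⟨ solve 2 (λ K l → con ½ :* (K :* l) := K :* (l :- con ½ :* l)) refl K (ℕ→ℚ ℓ) ⟩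
    K * (ℕ→ℚ ℓ - ½ * ℕ→ℚ ℓ)                ≤⟨ *-monoˡ-≤-nonNeg K {{nonNegative 0≤K}} (+-monoʳ-≤ (ℕ→ℚ ℓ) (neg-antimono-≤ a≤½ℓ)) ⟩
    K * (ℕ→ℚ ℓ - ℕ→ℚ (agreement x y))      ≡⟨ cong (K *_) (cong₂ _-_ (sym (trans (sumFin-const ℓ 1ℚ) (*-identityʳ (ℕ→ℚ ℓ)))) (ℕ→ℚ-agreement x y)) ⟩
    K * (sumFin ℓ (λ _ → 1ℚ) - sumFin ℓ (λ j → ℕ→ℚ (same (x j) (y j))))
                                           ≡⟨ cong (K *_) (sumFin-- ℓ (λ _ → 1ℚ) (λ j → ℕ→ℚ (same (x j) (y j)))) ⟨
    K * sumFin ℓ (λ j → 1ℚ - ℕ→ℚ (same (x j) (y j)))   ≡⟨ *-distribˡ-sumFin ℓ K _ ⟩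
    sumFin ℓ (λ j → K * (1ℚ - ℕ→ℚ (same (x j) (y j)))) ≤⟨ sumFin-mono-≤ ℓ (λ j → letter-gap 0≤K (x j) (y j)) ⟩
    sumFin ℓ (λ j → ∣ K * letter (x j) - K * letter (y j) ∣) ∎
    where
    open ≤-Reasoning
    open +-*-Solver
    a≤½ℓ : ℕ→ℚ (agreement x y) ≤ ½ * ℕ→ℚ ℓ
    a≤½ℓ = begin
      ℕ→ℚ (agreement x y)                  ≡⟨ solve 1 (λ a → a := con ½ :* (con (ℕ→ℚ 2) :* a)) refl (ℕ→ℚ (agreement x y)) ⟩
      ½ * (ℕ→ℚ 2 * ℕ→ℚ (agreement x y))    ≡⟨ cong (½ *_) (ℕ→ℚ-* 2 (agreement x y)) ⟨
      ½ * ℕ→ℚ (2 ℕ.* agreement x y)        ≤⟨ *-monoˡ-≤-nonNeg ½ (ℕ→ℚ-mono-≤ 2a≤ℓ) ⟩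
      ½ * ℕ→ℚ ℓ                            ∎

  -- The size has the form 2 ^ ℓ + c, so that `splitAt` separates the cube from c further vertices
  -- of V. Those carry weight ½ throughout and lie outside all test sets.
  module Construction {α} (0≤α : 0ℚ ≤ α) (ℓ c : ℕ) (x : Fin (2 ℕ.^ ℓ ℕ.+ c) → Fin ℓ → Fin 16) where

    N n : ℕ
    N = 2 ℕ.^ ℓ
    n = N ℕ.+ c

    β : Fin n → Fin ℓ → ℚ
    β u j = α * letter (x u j)

    β²≤ : ∀ u j → β u j * β u j ≤ α * ℕ→ℚ 16 * (α * ℕ→ℚ 16)
    β²≤ u j = p²-mono-≤ (0≤p*q 0≤α (0≤ℕ→ℚ (toℕ (x u j))))
      (*-monoˡ-≤-nonNeg α {{nonNegative 0≤α}} (ℕ→ℚ-mono-≤ (ℕ.<⇒≤ (toℕ<n (x u j)))))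

    onCube : ∀ {a} {A : Set a} → A → (Vec Bool ℓ → A) → Fin n → A
    onCube z f v = [ f ∘ bits ℓ , (λ _ → z) ]′ (splitAt N v)

    onCube-↑ˡ : ∀ {a} {A : Set a} (z : A) f i → onCube z f (i ↑ˡ c) ≡ f (bits ℓ i)
    onCube-↑ˡ z f i = cong [ f ∘ bits ℓ , (λ _ → z) ]′ (splitAt-↑ˡ N i c)

    onCube-↑ʳ : ∀ {a} {A : Set a} (z : A) f i → onCube z f (N ↑ʳ i) ≡ z
    onCube-↑ʳ z f i = cong [ f ∘ bits ℓ , (λ _ → z) ]′ (splitAt-↑ʳ N c i)

    w : Weights n
    w u = onCube ½ (weight (β u))

    w∈[0,1] : ℕ→ℚ ℓ * (α * ℕ→ℚ 16 * (α * ℕ→ℚ 16)) + ℕ→ℚ ℓ * (α * ℕ→ℚ 16 * (α * ℕ→ℚ 16)) ≤ 1ℚ → WeightsIn01 w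
    w∈[0,1] small u v with splitAt N v
    ... | inj₁ i = weight-∈[0,1] (0≤p² (α * ℕ→ℚ 16)) (β u) (β²≤ u) small (bits ℓ i)
    ... | inj₂ _ = *≤* (ℤ.+≤+ z≤n) , *≤* (ℤ.+≤+ (s≤s z≤n))

    b⁺ b⁻ : Fin ℓ → Fin n → Bool
    b⁺ j = onCube false (λ y → lookup y j)
    b⁻ j = onCube false (λ y → not (lookup y j))

    B⁺ B⁻ : Fin ℓ → Subset n
    B⁺ j = tabulate (b⁺ j)
    B⁻ j = tabulate (b⁻ j)

    χ-sign : ∀ b → χ b - χ (not b) ≡ sign b
    χ-sign true  = refl
    χ-sign false = refl

    signed-indicator : ∀ j v {a b} → b⁺ j v ≡ a → b⁻ j v ≡ b → indicator (B⁺ j) v - indicator (B⁻ j) v ≡ χ a - χ b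
    signed-indicator j v {a} {b} b⁺≡ b⁻≡ = cong₂ _-_
      (trans (indicator-tabulate (b⁺ j) v) (cong χ b⁺≡))
      (trans (indicator-tabulate (b⁻ j) v) (cong χ b⁻≡))

    -- Outside the cube both indicators vanish; on the cube their difference is the sign of
    -- coordinate j. What remains is an exact Fourier coefficient, proportional to the letter of u
    -- at j.
    signed-degree : ∀ j u →
      sumFin n (λ v → (indicator (B⁺ j) v - indicator (B⁻ j) v) * w u v) ≡ ¼ * (ℕ→ℚ N * α) * letter (x u j)
    signed-degree j u = begin
      sumFin n F                                                   ≡⟨ sumFin-++ N c F ⟩
      sumFin N (λ i → F (i ↑ˡ c)) + sumFin c (λ i → F (N ↑ʳ i))
        ≡⟨ cong₂ _+_ (sumFin-cong N onˡ) (trans (sumFin-cong c offʳ) (sumFin-zero c)) ⟩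
      sumFin N (λ i → G (bits ℓ i)) + 0ℚ                           ≡⟨ +-identityʳ (sumFin N (λ i → G (bits ℓ i))) ⟩
      sumFin N (λ i → G (bits ℓ i))                                ≡⟨ sumFin-bits ℓ G ⟩
      cubeSum ℓ G                                                  ≡⟨ cubeSum-sign-weight (β u) j ⟩
      ¼ * (ℕ→ℚ N * (α * letter (x u j)))                           ≡⟨ reassoc ¼ (ℕ→ℚ N) α (letter (x u j)) ⟩
      ¼ * (ℕ→ℚ N * α) * letter (x u j)                             ∎
      where
      open ≡-Reasoning
      F : Fin n → ℚ
      F v = (indicator (B⁺ j) v - indicator (B⁻ j) v) * w u v

      G : Vec Bool ℓ → ℚ
      G y = sign (lookup y j) * weight (β u) y

      reassoc : ∀ p q r s → p * (q * (r * s)) ≡ p * (q * r) * s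
      reassoc = solve 4 (λ p q r s → p :* (q :* (r :* s)) := p :* (q :* r) :* s) refl
        where open +-*-Solver

      onˡ : ∀ i → F (i ↑ˡ c) ≡ G (bits ℓ i)
      onˡ i = cong₂ _*_
        (trans (signed-indicator j (i ↑ˡ c)
                  (onCube-↑ˡ false (λ y → lookup y j) i) (onCube-↑ˡ false (λ y → not (lookup y j)) i))
               (χ-sign (lookup (bits ℓ i) j)))
        (onCube-↑ˡ ½ (weight (β u)) i)

      offʳ : ∀ i → F (N ↑ʳ i) ≡ 0ℚ
      offʳ i = trans
        (cong (_* w u (N ↑ʳ i)) (signed-indicator j (N ↑ʳ i)
          (onCube-↑ʳ false (λ y → lookup y j) i) (onCube-↑ʳ false (λ y → not (lookup y j)) i)))
        (*-zeroˡ (w u (N ↑ʳ i)))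

  module _ {n k k' ℓ} {ε K} (0≤K : 0ℚ ≤ K) (w : Weights n) (P₁ : Partition n k) (P₂ : Partition n k')
    (regular : WeakRegular ε w P₁ P₂)
    (x : Fin n → Fin ℓ → Fin 16) (separated : Separated x)
    (B⁺ B⁻ : Fin ℓ → Subset n)
    (signed-degree : ∀ j u →
      sumFin n (λ v → (indicator (B⁺ j) v - indicator (B⁻ j) v) * w u v) ≡ K * letter (x u j)) where

    private
      g : Fin ℓ → Fin k → ℚ
      g j i = partDegree w P₁ P₂ (B⁺ j) i - partDegree w P₁ P₂ (B⁻ j) i

      D : Fin n → ℚ
      D u = sumFin ℓ (λ j → ∣ K * letter (x u j) - g j (P₁ u) ∣)

      0≤D : ∀ u → 0ℚ ≤ D u
      0≤D u = sumFin-nonNeg ℓ (λ j → 0≤∣p∣ (K * letter (x u j) - g j (P₁ u)))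

      e : ℚ
      e = ε * ℕ→ℚ (n ℕ.* n)

      sum-D : sumFin n D ≤ ℕ→ℚ ℓ * ((e + e) + (e + e))
      sum-D = begin
        sumFin n D       ≡⟨ sumFin-comm n ℓ _ ⟩
        sumFin ℓ (λ j → sumFin n (λ u → ∣ K * letter (x u j) - g j (P₁ u) ∣))
          ≤⟨ sumFin-mono-≤ ℓ (λ j → ≤-trans
               (≤-reflexive (sumFin-cong n (λ u → cong (λ s → ∣ s - g j (P₁ u) ∣) (sym (signed-degree j u)))))
               (signed-degree-approx {ε = ε} w P₁ P₂ regular (B⁺ j) (B⁻ j))) ⟩
        sumFin ℓ (λ _ → (e + e) + (e + e))   ≡⟨ sumFin-const ℓ ((e + e) + (e + e)) ⟩
        ℕ→ℚ ℓ * ((e + e) + (e + e))          ∎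
        where open ≤-Reasoning

      -- Half of the distance ½ K ℓ that `far-apart` guarantees between two words.
      s : ℚ
      s = ¼ * (K * ℕ→ℚ ℓ)

      0≤s : 0ℚ ≤ s
      0≤s = 0≤p*q {¼} (*≤* (ℤ.+≤+ z≤n)) (0≤p*q 0≤K (0≤ℕ→ℚ ℓ))

      D-separated : ∀ {u v} → u ≢ v → P₁ u ≡ P₁ v → s + s ≤ D u + D v
      D-separated {u} {v} u≢v Pu≡Pv = begin
        s + s                                                              ≡⟨ *-distribʳ-+ (K * ℕ→ℚ ℓ) ¼ ¼ ⟨
        ½ * (K * ℕ→ℚ ℓ)                                                    ≤⟨ far-apart 0≤K (x u) (x v) (separated u≢v) ⟩
        -- Triangle inequality through the profile `g` of the part that u and v share.
        sumFin ℓ (λ j → ∣ K * letter (x u j) - K * letter (x v j) ∣)       ≤⟨ sumFin-mono-≤ ℓ (λ j → ∣p-q∣≤∣p-r∣+∣q-r∣ (K * letter (x u j)) (K * letter (x v j)) (g j (P₁ u))) ⟩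
        sumFin ℓ (λ j → ∣ K * letter (x u j) - g j (P₁ u) ∣ + ∣ K * letter (x v j) - g j (P₁ u) ∣)
          ≡⟨ sumFin-+ ℓ _ _ ⟩
        D u + sumFin ℓ (λ j → ∣ K * letter (x v j) - g j (P₁ u) ∣)
          ≡⟨ cong (λ i → D u + sumFin ℓ (λ j → ∣ K * letter (x v j) - g j i ∣)) Pu≡Pv ⟩
        D u + D v                                                          ∎
        where open ≤-Reasoning

    -- Two estimates of the sum of `D` over U: regularity bounds it above by 4 ε n² for each of the
    -- ℓ coordinates, and separation within the parts bounds it below.
    regular⇒≤ : ℕ→ℚ n * (¼ * (K * ℕ→ℚ ℓ)) ≤
      ℕ→ℚ ℓ * ((ε * ℕ→ℚ (n ℕ.* n) + ε * ℕ→ℚ (n ℕ.* n)) + (ε * ℕ→ℚ (n ℕ.* n) + ε * ℕ→ℚ (n ℕ.* n))) + ℕ→ℚ k * (¼ * (K * ℕ→ℚ ℓ))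
    regular⇒≤ = ≤-trans (separated-sum 0≤s D P₁ 0≤D D-separated) (+-monoˡ-≤ (ℕ→ℚ k * s) sum-D)

  -- Here ν = n, M = 2 ^ ℓ, l = ℓ and κ = k. In units of Z = ν M ε l the left side is 32 Z, the
  -- regularity term is at most 8 Z because ν ≤ 2M, and the last term is at most 16 Z because 2κ ≤
  -- ν. So 32 Z ≤ 24 Z with Z positive, which is absurd.
  balance : ∀ {ε ν M l κ} → 0ℚ < ε → 0ℚ < ν → 0ℚ < M → 0ℚ < l → ν ≤ ℕ→ℚ 2 * M → κ * ℕ→ℚ 2 ≤ ν →
    ¬ (ν * (¼ * (¼ * (M * (ε * ℕ→ℚ 512)) * l)) ≤
       l * ((ε * (ν * ν) + ε * (ν * ν)) + (ε * (ν * ν) + ε * (ν * ν))) + κ * (¼ * (¼ * (M * (ε * ℕ→ℚ 512)) * l)))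
  balance {ε} {ν} {M} {l} {κ} 0<ε 0<ν 0<M 0<l ν≤2M 2κ≤ν approx = <⇒≱ 0<Z (*-cancelˡ-≤-pos (ℕ→ℚ 16) (begin
    ℕ→ℚ 16 * Z                                          ≡⟨ solve 1 (λ Z → con (ℕ→ℚ 16) :* Z := con (ℕ→ℚ 2) :* (con (ℕ→ℚ 32) :* Z) :- con (ℕ→ℚ 48) :* Z) refl Z ⟩
    ℕ→ℚ 2 * (ℕ→ℚ 32 * Z) - ℕ→ℚ 48 * Z                   ≡⟨ cong (λ m → ℕ→ℚ 2 * m - ℕ→ℚ 48 * Z) νs≡32Z ⟨
    ℕ→ℚ 2 * (ν * s) - ℕ→ℚ 48 * Z                        ≤⟨ +-monoˡ-≤ (- (ℕ→ℚ 48 * Z)) doubled ⟩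
    ℕ→ℚ 2 * (ℕ→ℚ 8 * Z) + ℕ→ℚ 32 * Z - ℕ→ℚ 48 * Z       ≡⟨ solve 1 (λ Z → con (ℕ→ℚ 2) :* (con (ℕ→ℚ 8) :* Z) :+ con (ℕ→ℚ 32) :* Z :- con (ℕ→ℚ 48) :* Z := con (ℕ→ℚ 16) :* con 0ℚ) refl Z ⟩
    ℕ→ℚ 16 * 0ℚ                                         ∎))
    where
    open ≤-Reasoning
    open +-*-Solver
    Z s 4e r : ℚ
    Z = ν * (M * (ε * l))
    s = ¼ * (¼ * (M * (ε * ℕ→ℚ 512)) * l)
    4e = (ε * (ν * ν) + ε * (ν * ν)) + (ε * (ν * ν) + ε * (ν * ν))
    r = ℕ→ℚ 4 * (l * (ε * ν))

    0<Z : 0ℚ < Z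
    0<Z = 0<p*q 0<ν (0<p*q 0<M (0<p*q 0<ε 0<l))

    0≤r : 0ℚ ≤ r
    0≤r = 0≤p*q (0≤ℕ→ℚ 4) (<⇒≤ (0<p*q 0<l (0<p*q 0<ε 0<ν)))

    0≤s : 0ℚ ≤ s
    0≤s = 0≤p*q {¼} (*≤* (ℤ.+≤+ z≤n)) (0≤p*q (0≤p*q {¼} (*≤* (ℤ.+≤+ z≤n))
      (0≤p*q (<⇒≤ 0<M) (0≤p*q (<⇒≤ 0<ε) (0≤ℕ→ℚ 512)))) (<⇒≤ 0<l))

    νs≡32Z : ν * s ≡ ℕ→ℚ 32 * Z
    νs≡32Z = solve 4 (λ n N e l → n :* (con ¼ :* (con ¼ :* (N :* (e :* con (ℕ→ℚ 512))) :* l)) := con (ℕ→ℚ 32) :* (n :* (N :* (e :* l)))) refl ν M ε l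

    4le≤8Z : l * 4e ≤ ℕ→ℚ 8 * Z
    4le≤8Z = begin
      l * 4e                ≡⟨ solve 3 (λ l e n → l :* ((e :* (n :* n) :+ e :* (n :* n)) :+ (e :* (n :* n) :+ e :* (n :* n))) := con (ℕ→ℚ 4) :* (l :* (e :* n)) :* n) refl l ε ν ⟩
      r * ν                 ≤⟨ *-monoˡ-≤-nonNeg r {{nonNegative 0≤r}} ν≤2M ⟩
      r * (ℕ→ℚ 2 * M)       ≡⟨ solve 4 (λ l e n N → con (ℕ→ℚ 4) :* (l :* (e :* n)) :* (con (ℕ→ℚ 2) :* N) := con (ℕ→ℚ 8) :* (n :* (N :* (e :* l)))) refl l ε ν M ⟩
      ℕ→ℚ 8 * Z             ∎

    -- Doubling allows the hypothesis on 2κ to be applied without halving ν.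
    doubled : ℕ→ℚ 2 * (ν * s) ≤ ℕ→ℚ 2 * (ℕ→ℚ 8 * Z) + ℕ→ℚ 32 * Z
    doubled = begin
      ℕ→ℚ 2 * (ν * s)                       ≤⟨ *-monoˡ-≤-nonNeg (ℕ→ℚ 2) approx ⟩
      ℕ→ℚ 2 * (l * 4e + κ * s)              ≡⟨ solve 3 (λ d k s → con (ℕ→ℚ 2) :* (d :+ k :* s) := con (ℕ→ℚ 2) :* d :+ k :* con (ℕ→ℚ 2) :* s) refl (l * 4e) κ s ⟩
      ℕ→ℚ 2 * (l * 4e) + κ * ℕ→ℚ 2 * s      ≤⟨ +-mono-≤ (*-monoˡ-≤-nonNeg (ℕ→ℚ 2) 4le≤8Z) (*-monoʳ-≤-nonNeg s {{nonNegative 0≤s}} 2κ≤ν) ⟩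
      ℕ→ℚ 2 * (ℕ→ℚ 8 * Z) + ν * s           ≡⟨ cong (ℕ→ℚ 2 * (ℕ→ℚ 8 * Z) +_) νs≡32Z ⟩
      ℕ→ℚ 2 * (ℕ→ℚ 8 * Z) + ℕ→ℚ 32 * Z      ∎

-- Translation of the floor condition into bounds on ℓ and ε.

module Exponents where
  open import Data.Nat.Base
  open import Data.Nat.Properties
  open import Data.Product.Base using (∃₂; _×_; _,_)
  open import Data.Rational.Base as ℚ using (ℚ; 0ℚ; 1ℚ; nonNegative; positive)
  import Data.Rational.Properties as ℚ
  open import Data.Rational.Solver using (module +-*-Solver)
  open import Relation.Binary.PropositionalEquality
  open import Relation.Nullary using (yes; no; contradiction)
  open RationalSums hiding (<⇒≱)
  open LowerBound

  ^-cancelˡ-≤ : ∀ {i j} → 2 ^ i ≤ 2 ^ j → i ≤ j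
  ^-cancelˡ-≤ {i} {j} 2^i≤2^j with i ≤? j
  ... | yes i≤j = i≤j
  ... | no  i≰j = contradiction 2^i≤2^j (<⇒≱ (^-monoʳ-< 2 (s≤s (s≤s z≤n)) (≰⇒> i≰j)))

  -- Adding one either stays below 2 ^ (ℓ + 1) or reaches it exactly; then ℓ grows and the remainder
  -- resets to 0. The sum form is the one `Construction` asks for.
  floor-log₂ : ∀ n → 0 < n → ∃₂ λ ℓ c → n ≡ 2 ^ ℓ + c × n < 2 ^ suc ℓ
  floor-log₂ (suc zero)    _ = 0 , 0 , refl , s≤s (s≤s z≤n)
  floor-log₂ (suc n@(suc _)) _ with floor-log₂ n (s≤s z≤n)
  ... | ℓ , c , n≡ , n<2^ with suc n <? 2 ^ suc ℓ
  ...   | yes 1+n<2^ = ℓ , suc c , trans (cong suc n≡) (sym (+-suc (2 ^ ℓ) c)) , 1+n<2^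
  ...   | no  1+n≮2^ = suc ℓ , 0 , trans 1+n≡2^ (sym (+-identityʳ (2 ^ suc ℓ))) ,
    subst (_< 2 ^ suc (suc ℓ)) (sym 1+n≡2^) (^-monoʳ-< 2 (s≤s (s≤s z≤n)) (n<1+n (suc ℓ)))
    where
    1+n≡2^ : suc n ≡ 2 ^ suc ℓ
    1+n≡2^ = ≤-antisym n<2^ (≮⇒≥ 1+n≮2^)

  -- Base-2 logarithms without real numbers: ℓ ≤ log n ≤ a / b, kept in multiplied form.
  log-bound : ∀ {ℓ n} a b → 2 ^ ℓ ≤ n → n ^ b ≤ 2 ^ a → ℓ * b ≤ a
  log-bound {ℓ} {n} a b 2^ℓ≤n n^b≤2^a = ^-cancelˡ-≤ (begin
    2 ^ (ℓ * b)   ≡⟨ ^-*-assoc 2 ℓ b ⟨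
    (2 ^ ℓ) ^ b   ≤⟨ ^-monoˡ-≤ b 2^ℓ≤n ⟩
    n ^ b         ≤⟨ n^b≤2^a ⟩
    2 ^ a         ∎)
    where open ≤-Reasoning

  ℕ→ℚ-cancel-≤ : ∀ {m n} → ℕ→ℚ m ℚ.≤ ℕ→ℚ n → m ≤ n
  ℕ→ℚ-cancel-≤ {m} {n} m≤n with m ≤? n
  ... | yes p = p
  ... | no  m≰n = contradiction (ℚ.≤-trans (ℕ→ℚ-mono-≤ (≰⇒> m≰n)) m≤n) (RationalSums.<⇒≱ (begin-strict
    ℕ→ℚ n              ≡⟨ ℚ.+-identityˡ (ℕ→ℚ n) ⟨
    0ℚ ℚ.+ ℕ→ℚ n       <⟨ ℚ.+-monoˡ-< (ℕ→ℚ n) (0<ℕ→ℚ {1} (s≤s z≤n)) ⟩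
    1ℚ ℚ.+ ℕ→ℚ n       ≡⟨ ℕ→ℚ-+ 1 n ⟨
    ℕ→ℚ (suc n)        ∎))
    where open ℚ.≤-Reasoning

  module _ {ε} (0<ε : 0ℚ ℚ.< ε) where
    private
      p r : ℕ
      p = numε ε
      r = denε ε
      R : ℚ
      R = ℕ→ℚ r
      0<R : 0ℚ ℚ.< R
      0<R = 0<ℕ→ℚ {r} (s≤s z≤n)

    -- The origin of 27: t = (512 * 16 * ε)² = 2 ^ 26 ε², so 2ℓt = 2 ^ 27 ℓ ε². Multiplying by the
    -- squared denominator of ε turns the claim into the bound on ℓ in natural numbers.
    energy-≤1 : ∀ c → 27 ≤ c → ∀ ℓ → ℓ * (2 ^ c * (p * p)) ≤ r * r →
      let t = ε ℚ.* ℕ→ℚ 512 ℚ.* ℕ→ℚ 16 ℚ.* (ε ℚ.* ℕ→ℚ 512 ℚ.* ℕ→ℚ 16) in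
      ℕ→ℚ ℓ ℚ.* t ℚ.+ ℕ→ℚ ℓ ℚ.* t ℚ.≤ 1ℚ
    energy-≤1 c 27≤c ℓ ℓb≤a = ℚ.*-cancelʳ-≤-pos (R ℚ.* R) {{positive (0<p*q 0<R 0<R)}} (begin
      (ℕ→ℚ ℓ ℚ.* t ℚ.+ ℕ→ℚ ℓ ℚ.* t) ℚ.* (R ℚ.* R)
        ≡⟨ solve 3 (λ l e R →
             (l :* (e :* con (ℕ→ℚ 512) :* con (ℕ→ℚ 16) :* (e :* con (ℕ→ℚ 512) :* con (ℕ→ℚ 16)))
               :+ l :* (e :* con (ℕ→ℚ 512) :* con (ℕ→ℚ 16) :* (e :* con (ℕ→ℚ 512) :* con (ℕ→ℚ 16)))) :* (R :* R)
             := l :* (con (ℕ→ℚ (2 ^ 27)) :* (e :* R :* (e :* R)))) refl (ℕ→ℚ ℓ) ε R ⟩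
      ℕ→ℚ ℓ ℚ.* (ℕ→ℚ (2 ^ 27) ℚ.* (ε ℚ.* R ℚ.* (ε ℚ.* R)))
        ≡⟨ cong (λ s → ℕ→ℚ ℓ ℚ.* (ℕ→ℚ (2 ^ 27) ℚ.* (s ℚ.* s))) (num≡ε*den 0<ε) ⟩
      ℕ→ℚ ℓ ℚ.* (ℕ→ℚ (2 ^ 27) ℚ.* (ℕ→ℚ p ℚ.* ℕ→ℚ p))
        ≡⟨ collect (2 ^ 27) ⟨
      ℕ→ℚ (ℓ * (2 ^ 27 * (p * p)))
        ≤⟨ ℕ→ℚ-mono-≤ (≤-trans (*-monoʳ-≤ ℓ (*-monoˡ-≤ (p * p) (^-monoʳ-≤ 2 27≤c))) ℓb≤a) ⟩
      ℕ→ℚ (r * r)     ≡⟨ ℕ→ℚ-* r r ⟩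
      R ℚ.* R         ≡⟨ ℚ.*-identityˡ (R ℚ.* R) ⟨
      1ℚ ℚ.* (R ℚ.* R) ∎)
      where
      open ℚ.≤-Reasoning
      open +-*-Solver
      t = ε ℚ.* ℕ→ℚ 512 ℚ.* ℕ→ℚ 16 ℚ.* (ε ℚ.* ℕ→ℚ 512 ℚ.* ℕ→ℚ 16)
      collect : ∀ m → ℕ→ℚ (ℓ * (m * (p * p))) ≡ ℕ→ℚ ℓ ℚ.* (ℕ→ℚ m ℚ.* (ℕ→ℚ p ℚ.* ℕ→ℚ p))
      collect m = trans (ℕ→ℚ-* ℓ (m * (p * p))) (cong (ℕ→ℚ ℓ ℚ.*_)
        (trans (ℕ→ℚ-* m (p * p)) (cong (ℕ→ℚ m ℚ.*_) (ℕ→ℚ-* p p))))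

    num*≤den : ∀ m → ε ℚ.* ℕ→ℚ m ℚ.≤ 1ℚ → m * p ≤ r
    num*≤den m εm≤1 = ℕ→ℚ-cancel-≤ (begin
      ℕ→ℚ (m * p)              ≡⟨ ℕ→ℚ-* m p ⟩
      ℕ→ℚ m ℚ.* ℕ→ℚ p          ≡⟨ cong (ℕ→ℚ m ℚ.*_) (num≡ε*den 0<ε) ⟨
      ℕ→ℚ m ℚ.* (ε ℚ.* R)      ≡⟨ solve 3 (λ m e R → m :* (e :* R) := e :* m :* R) refl (ℕ→ℚ m) ε R ⟩
      ε ℚ.* ℕ→ℚ m ℚ.* R        ≤⟨ ℚ.*-monoʳ-≤-nonNeg R {{nonNegative (ℚ.<⇒≤ 0<R)}} εm≤1 ⟩
      1ℚ ℚ.* R                 ≡⟨ ℚ.*-identityˡ R ⟩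
      R                        ∎)
      where
      open ℚ.≤-Reasoning
      open +-*-Solver

    -- In terms of `IsFloorPow2` the exponent of 2 is at least 1. This is what makes the floor at
    -- least 2.
    2^*num²≤den² : ∀ c m → c ≤ m + m → ε ℚ.* ℕ→ℚ (2 ^ m) ℚ.≤ 1ℚ → 2 ^ c * (p * p) ≤ r * r
    2^*num²≤den² c m c≤2m ε2^m≤1 = begin
      2 ^ c * (p * p)              ≤⟨ *-monoˡ-≤ (p * p) (^-monoʳ-≤ 2 c≤2m) ⟩
      2 ^ (m + m) * (p * p)        ≡⟨ cong (_* (p * p)) (^-distribˡ-+-* 2 m m) ⟩
      2 ^ m * 2 ^ m * (p * p)      ≡⟨ [m*n]*[o*p]≡[m*o]*[n*p] (2 ^ m) (2 ^ m) p p ⟩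
      2 ^ m * p * (2 ^ m * p)      ≤⟨ *-mono-≤ (num*≤den (2 ^ m) ε2^m≤1) (num*≤den (2 ^ m) ε2^m≤1) ⟩
      r * r                        ∎
      where open ≤-Reasoning

-- Irregular graphs of the required sizes and the bound on the number of parts.

module Irregularity where
  open import Data.Fin.Base using (Fin; fromℕ<)
  open import Data.Nat.Base
  open import Data.Nat.Properties
  open import Data.Product.Base using (Σ; _×_; _,_; proj₁; proj₂)
  open import Data.Rational.Base as ℚ using (ℚ; 0ℚ; 1ℚ)
  import Data.Rational.Properties as ℚ
  open import Relation.Binary.PropositionalEquality
  open import Relation.Nullary using (¬_; contradiction)
  open RationalSums hiding (<⇒≱)
  open Codes
  open RieszProducts
  open LowerBound
  open Exponents

  -- Named as a family in n so that it can be transported along the equation n = 2 ^ ℓ + c.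
  IrregularGraph : ℚ → ℕ → Set
  IrregularGraph ε n = Σ (Weights n) λ w → WeightsIn01 w ×
    (∀ (k k' : ℕ) (P₁ : Partition n k) (P₂ : Partition n k') → k * 2 ≤ n → ¬ WeakRegular ε w P₁ P₂)

  irregular-2^ℓ+c : ∀ {ε} → 0ℚ ℚ.< ε → ∀ d → 27 ≤ d → ∀ ℓ c → 2 ^ ℓ + c < 2 ^ suc ℓ →
    ℓ * (2 ^ d * (numε ε * numε ε)) ≤ denε ε * denε ε → IrregularGraph ε (2 ^ ℓ + c)
  irregular-2^ℓ+c {ε} 0<ε d 27≤d ℓ c n<2^ ℓb≤a =
    w , w∈[0,1] (energy-≤1 0<ε d 27≤d ℓ ℓb≤a) , λ k k' P₁ P₂ 2k≤n regular →
      -- Some vertex of U has a label, so k ≥ 1; then n ≥ 2 and hence ℓ ≥ 1, the positivity that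
      -- `balance` demands of ℓ.
      balance {κ = ℕ→ℚ k} 0<ε (0<ℕ→ℚ 0<n) (0<ℕ→ℚ 0<N) (0<ℕ→ℚ (0<ℓ (≤-trans (*-monoˡ-≤ 2 (inhabited (P₁ (fromℕ< 0<n)))) 2k≤n)))
        (ℚ.≤-trans (ℕ→ℚ-mono-≤ (<⇒≤ n<2^)) (ℚ.≤-reflexive (ℕ→ℚ-* 2 N)))
        (ℚ.≤-trans (ℚ.≤-reflexive (sym (ℕ→ℚ-* k 2))) (ℕ→ℚ-mono-≤ 2k≤n))
        (subst (λ m → ℕ→ℚ n ℚ.* s ℚ.≤ ℕ→ℚ ℓ ℚ.* ((ε ℚ.* m ℚ.+ ε ℚ.* m) ℚ.+ (ε ℚ.* m ℚ.+ ε ℚ.* m)) ℚ.+ ℕ→ℚ k ℚ.* s)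
          (ℕ→ℚ-* n n) (regular⇒≤ {ε = ε} 0≤K w P₁ P₂ regular (proj₁ code) (proj₂ code) B⁺ B⁻ signed-degree))
    where
    code = separated-code ℓ (2 ^ ℓ + c) (<⇒≤ n<2^)

    0≤α : 0ℚ ℚ.≤ ε ℚ.* ℕ→ℚ 512
    0≤α = 0≤p*q (ℚ.<⇒≤ 0<ε) (0≤ℕ→ℚ 512)

    open Construction 0≤α ℓ c (proj₁ code)

    0≤K : 0ℚ ℚ.≤ ¼ ℚ.* (ℕ→ℚ N ℚ.* (ε ℚ.* ℕ→ℚ 512))
    0≤K = 0≤p*q {¼} (ℚ.nonNegative⁻¹ ¼) (0≤p*q (0≤ℕ→ℚ N) 0≤α)

    s : ℚ
    s = ¼ ℚ.* (¼ ℚ.* (ℕ→ℚ N ℚ.* (ε ℚ.* ℕ→ℚ 512)) ℚ.* ℕ→ℚ ℓ)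

    0<N : 0 < N
    0<N = m^n>0 2 ℓ

    0<n : 0 < n
    0<n = ≤-trans 0<N (m≤m+n N c)

    inhabited : ∀ {k} → Fin k → 1 ≤ k
    inhabited {suc _} _ = s≤s z≤n

    0<ℓ : 2 ≤ n → 0 < ℓ
    0<ℓ 2≤n = s<s⁻¹ (≰⇒> λ 1+ℓ≤1 → <⇒≱ (≤-<-trans 2≤n n<2^) (^-monoʳ-≤ 2 1+ℓ≤1))

  -- Stated for every positive n with n ^ b ≤ 2 ^ a, so that it serves both the floor itself and the
  -- square N * N.
  irregular-graph : ∀ {ε} → 0ℚ ℚ.< ε → ∀ d → 27 ≤ d → ∀ n → 0 < n →
    n ^ (2 ^ d * (numε ε * numε ε)) ≤ 2 ^ (denε ε * denε ε) → IrregularGraph ε n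
  irregular-graph {ε} 0<ε d 27≤d n 0<n n^b≤2^a =
    let ℓ , c , n≡ , n<2^ = floor-log₂ n 0<n
        2^ℓ≤n = ≤-trans (m≤m+n (2 ^ ℓ) c) (≤-reflexive (sym n≡))
    in subst (IrregularGraph ε) (sym n≡)
         (irregular-2^ℓ+c 0<ε d 27≤d ℓ c (subst (_< 2 ^ suc ℓ) n≡ n<2^)
           (log-bound {ℓ} (denε ε * denε ε) (2 ^ d * (numε ε * numε ε)) 2^ℓ≤n n^b≤2^a))

  irregular-floor : ∀ {ε} → 0ℚ ℚ.< ε → ∀ d → 27 ≤ d → ∀ n → IsFloorPow2 n d ε → IrregularGraph ε n
  irregular-floor {ε} 0<ε d 27≤d n (n^b≤2^a , 2^a<[1+n]^b) = irregular-graph 0<ε d 27≤d n (0<n n 2^a<[1+n]^b) n^b≤2^a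
    where
    a b : ℕ
    a = denε ε * denε ε
    b = 2 ^ d * (numε ε * numε ε)
    -- The value 0 is excluded by the lower half of the floor condition, since 2 ^ a < 1 ^ b = 1 is
    -- impossible.
    0<n : ∀ n → 2 ^ a < suc n ^ b → 0 < n
    0<n zero    2^a<1 = contradiction (m^n>0 2 a) (<⇒≱ (<-≤-trans 2^a<1 (≤-reflexive (^-zeroˡ b))))
    0<n (suc _) _     = s≤s z≤n

  -- A graph on N² vertices forces more than N²/2 ≥ N parts.
  ¬regularity-floor : ∀ {ε} → 0ℚ ℚ.< ε → ∀ d m → 27 ≤ d → suc d ≤ m + m → ε ℚ.* ℕ→ℚ (2 ^ m) ℚ.≤ 1ℚ →
    ∀ N → IsFloorPow2 N (suc d) ε → ¬ RegularityHolds ε N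
  ¬regularity-floor {ε} 0<ε d m 27≤d 1+d≤2m ε2^m≤1 N (N^b≤2^a , 2^a<[1+N]^b) holds =
    let w , w∈[0,1] , irregular = graph
        k , k' , k≤N , _ , P₁ , P₂ , regular = holds (N * N) w w∈[0,1]
    in irregular k k' P₁ P₂ (*-mono-≤ k≤N 1<N) regular
    where
    a b p² : ℕ
    a = denε ε * denε ε
    p² = numε ε * numε ε
    b = 2 ^ suc d * p²

    -- If N ≤ 1, then (N + 1) ^ b ≤ 2 ^ b ≤ 2 ^ a, against the floor condition. With N ≥ 2, any k ≤
    -- N satisfies 2k ≤ N * N.
    1<N : 1 < N
    1<N = ≰⇒> λ N≤1 → <⇒≱ 2^a<[1+N]^b
      (≤-trans (^-monoˡ-≤ b (s≤s N≤1)) (^-monoʳ-≤ 2 (2^*num²≤den² 0<ε (suc d) m 1+d≤2m ε2^m≤1)))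

    -- Squaring N uses up one factor 2 of the exponent b, so the condition on N with d + 1 is
    -- exactly the condition on N * N with d.
    graph : IrregularGraph ε (N * N)
    graph = irregular-graph 0<ε d 27≤d (N * N) (*-mono-≤ (<⇒≤ 1<N) (<⇒≤ 1<N)) (begin
      (N * N) ^ (2 ^ d * p²)         ≡⟨ cong (λ m → (N * m) ^ (2 ^ d * p²)) (*-identityʳ N) ⟨
      (N ^ 2) ^ (2 ^ d * p²)         ≡⟨ ^-*-assoc N 2 (2 ^ d * p²) ⟩
      N ^ (2 * (2 ^ d * p²))         ≡⟨ cong (N ^_) (*-assoc 2 (2 ^ d) p²) ⟨
      N ^ b                          ≤⟨ N^b≤2^a ⟩
      2 ^ a                          ∎)
      where open ≤-Reasoning

open import Data.Nat using (ℕ; _*_; _≤_; _^_)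
open import Data.Nat.Properties using (m≤m+n)
open import Data.Integer using (+_)
open import Data.Rational using (ℚ; 0ℚ; 1ℚ; _<_; _/_) renaming (_≤_ to _≤ℚ_; _*_ to _*ℚ_)
open import Data.Product using (Σ; _×_; _,_)
open import Relation.Nullary using (¬_)
open Irregularity using (irregular-floor; ¬regularity-floor)

theorem7p12 : ∀ (ε : ℚ) → 0ℚ < ε → ε *ℚ (+ (2 ^ 50) / 1) ≤ℚ 1ℚ →
  (∀ (n : ℕ) → IsFloorPow2 n 45 ε →
  Σ (Weights n) λ w → WeightsIn01 w ×
  (∀ (k k' : ℕ) (P₁ : Partition n k) (P₂ : Partition n k') →
  k * 2 ≤ n → ¬ WeakRegular ε w P₁ P₂))
  × (∀ (N : ℕ) → IsFloorPow2 N 46 ε → ¬ RegularityHolds ε N)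
theorem7p12 ε 0<ε ε≤2^-50 =
  irregular-floor 0<ε 45 (m≤m+n 27 18) ,
  -- The choice m = 50 is the hypothesis on ε, and 46 ≤ 50 + 50 makes the exponent at least 1.
  ¬regularity-floor 0<ε 45 50 (m≤m+n 27 18) (m≤m+n 46 54) ε≤2^-50
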